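{- For identical machines with cardinality-budget uncertainty and every real $\lambda>0$, there is a deterministic algorithm that, given the numbers of machines $m$ and jobs $n$, lower and upper job sizes $p^-,p^+\in\mathbb R_{\ge0}^n$ with $p^-\le p^+$, and a predicted size vector $\hat p$ with $p^-\le\hat p\le p^+$, computes a schedule $\mathcal S$, independently of the budget $\Gamma$, such that $$C_{\max}(\mathcal S,\hat p)\le\Big(1+\frac2\lambda\Big)\mathrm{OPT}(\hat p)$$ and, simultaneously for every $\Gamma\in\{1,\dots,n\}$, $$\max_{p\in\mathcal U_\Gamma}C_{\max}(\mathcal S,p)\le(10\lambda+20)\,\mathrm{OPT}^{\mathrm{rob}}(\mathcal U_\Gamma).$$
   Context: There are $m$ identical machines and $n$ jobs; a scenario is a vector $p\in\mathbb R_{\ge0}^n$ of job sizes. A schedule is a partition $\mathcal S=(S_1,\dots,S_m)$ of $[n]$ (parts may be empty), and $C_{\max}(\mathcal S,p)=\max_{i\in[m]}\sum_{j\in S_i}p_j$. $\mathrm{OPT}(p)=\min_{\mathcal S}C_{\max}(\mathcal S,p)$ and $\mathrm{OPT}^{\mathrm{rob}}(\mathcal U)=\min_{\mathcal S}\max_{p\in\mathcal U}C_{\max}(\mathcal S,p)$. For an integer $\Gamma\in\{1,\dots,n\}$, the cardinality-budget uncertainty set is $$\mathcal U_\Gamma=\{p:\exists\,T\subseteq[n],\ |T|\le\Gamma,\ p_j=p_j^-\text{ for }j\notin T,\ p_j\in[p_j^-,p_j^+]\text{ for }j\in T\}.$$ No computational restriction is imposed on the algorithm. -}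

module Defs where

open import Algebra.Bundles using (CommutativeRing; Monoid)
open import Algebra.Structures using (IsCommutativeRing)
open import Data.Bool.Base using (Bool; true; false; if_then_else_)
open import Data.Empty using (⊥-elim)
open import Data.Fin.Base using (Fin; zero; suc)
import Data.Fin.Properties as Fin
open import Data.Fin.Subset using (Subset; _∈_; _∉_; ∣_∣; ⊥)
open import Data.Fin.Subset.Properties using (_∈?_; ∉⊥; ∣⊥∣≡0; ⊆-antisym)
open import Data.List.Base as List using (List; []; _∷_; cartesianProductWith; allFin)
import Data.List.Extrema as Extrema
import Data.List.Membership.Propositional as List∈
open import Data.List.Membership.Propositional.Properties
  using (∈-cartesianProductWith⁺; ∈-allFin; ∈-map⁺)
open import Data.List.Relation.Unary.All as All using (All)
open import Data.List.Relation.Unary.Any using (here; there)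
open import Data.Nat.Base as ℕ using (ℕ; zero; suc; NonZero)
import Data.Nat.Properties as ℕ
open import Data.Product using (∃; ∃-syntax; _×_; _,_; proj₁; proj₂)
open import Data.Vec.Base as Vec using (Vec; []; _∷_; lookup; tabulate; replicate)
open import Data.Vec.Properties using (lookup∘tabulate; lookup⇒[]=; []=⇒lookup)
open import Level using (0ℓ)
open import Relation.Binary.Bundles using (TotalOrder)
open import Relation.Binary.PropositionalEquality
open import Relation.Binary.Structures using (IsDecTotalOrder)
import Relation.Binary.Construct.NonStrictToStrict as NonStrictToStrict
open import Relation.Nullary using (Dec; yes; no; does)

-- The real numbers, characterised classically as a Dedekind-complete ordered
-- field.  The order is decidable because the reading of ℝ is the classical one.
record Reals : Set₁ where
  infix  8 _⁻¹
  infix  8 -_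
  infixl 7 _*_
  infixl 6 _+_
  infix  4 _≤_
  field
    Carrier : Set
    _+_ _*_ : Carrier → Carrier → Carrier
    -_      : Carrier → Carrier
    0# 1#   : Carrier
    -- 0# ⁻¹ is unspecified.
    _⁻¹     : Carrier → Carrier
    _≤_     : Carrier → Carrier → Set

    isCommutativeRing : IsCommutativeRing _≡_ _+_ _*_ -_ 0# 1#
    0≢1               : 0# ≢ 1#
    *-inverseʳ        : ∀ x → x ≢ 0# → x * x ⁻¹ ≡ 1#

    isDecTotalOrder   : IsDecTotalOrder _≡_ _≤_
    +-monoʳ-≤         : ∀ z {x y} → x ≤ y → z + x ≤ z + y
    *-nonNegative     : ∀ {x y} → 0# ≤ x → 0# ≤ y → 0# ≤ x * y

    supremum : (P : Carrier → Set) → ∃ P → (∃[ b ] ∀ x → P x → x ≤ b) →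
               ∃[ s ] (∀ x → P x → x ≤ s) × (∀ b → (∀ x → P x → x ≤ b) → s ≤ b)

  commutativeRing : CommutativeRing 0ℓ 0ℓ
  commutativeRing = record { isCommutativeRing = isCommutativeRing }

  totalOrder : TotalOrder 0ℓ 0ℓ 0ℓ
  totalOrder = record { isTotalOrder = IsDecTotalOrder.isTotalOrder isDecTotalOrder }

  infix 4 _<_
  _<_ : Carrier → Carrier → Set
  _<_ = NonStrictToStrict._<_ _≡_ _≤_

  open Monoid (CommutativeRing.+-monoid commutativeRing) using (rawMonoid)
  open import Algebra.Definitions.RawMonoid rawMonoid public using (sum)
    renaming (_×_ to _·_)

  fromℕ : ℕ → Carrier
  fromℕ k = k · 1#

-- A partition of the n jobs into m parts indexed by the machines; empty parts are
-- allowed.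
record Schedule (m n : ℕ) : Set where
  field
    part     : Fin m → Subset n
    covers   : ∀ j → ∃[ i ] j ∈ part i
    disjoint : ∀ {i k j} → j ∈ part i → j ∈ part k → i ≡ k

module _ {m n : ℕ} where

  fromAssignment : Vec (Fin m) n → Schedule m n
  fromAssignment σ = record
    { part     = part
    ; covers   = λ j → lookup σ j , ∈-part j
    ; disjoint = λ j∈i j∈k → trans (sym (part-∈ j∈i)) (part-∈ j∈k)
    }
    where
    part : Fin m → Subset n
    part i = tabulate λ j → does (lookup σ j Fin.≟ i)

    ∈-part : ∀ j → j ∈ part (lookup σ j)
    ∈-part j = lookup⇒[]= j _ (trans (lookup∘tabulate _ j) eq)
      where
      eq : does (lookup σ j Fin.≟ lookup σ j) ≡ true
      eq with lookup σ j Fin.≟ lookup σ j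
      ... | yes _  = refl
      ... | no x≢x = ⊥-elim (x≢x refl)

    part-∈ : ∀ {i j} → j ∈ part i → lookup σ j ≡ i
    part-∈ {i} {j} j∈i with lookup σ j Fin.≟ i
                          | trans (sym (lookup∘tabulate (λ j → does (lookup σ j Fin.≟ i)) j))
                                  ([]=⇒lookup j∈i)
    ... | yes eq | _ = eq
    ... | no _   | ()

  toAssignment : Schedule m n → Vec (Fin m) n
  toAssignment S = tabulate λ j → proj₁ (Schedule.covers S j)

  part-fromTo : ∀ S i j → j ∈ Schedule.part S i →
                j ∈ Schedule.part (fromAssignment (toAssignment S)) i
  part-fromTo S i j j∈i = subst (λ k → j ∈ T.part k) k≡i j∈k
    where
    module S = Schedule S
    module T = Schedule (fromAssignment (toAssignment S))
    j∈k : j ∈ T.part (proj₁ (T.covers j))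
    j∈k = proj₂ (T.covers j)
    k≡i : lookup (toAssignment S) j ≡ i
    k≡i = trans (lookup∘tabulate _ j) (S.disjoint (proj₂ (S.covers j)) j∈i)

  part-toFrom : ∀ S i j → j ∈ Schedule.part (fromAssignment (toAssignment S)) i →
                j ∈ Schedule.part S i
  part-toFrom S i j j∈i = subst (λ k → j ∈ S.part k) k≡i (proj₂ (S.covers j))
    where
    module S = Schedule S
    module T = Schedule (fromAssignment (toAssignment S))
    k≡i : proj₁ (S.covers j) ≡ i
    k≡i = trans (sym (lookup∘tabulate _ j)) (T.disjoint (proj₂ (T.covers j)) j∈i)

vectors : ∀ {A : Set} → List A → (n : ℕ) → List (Vec A n)
vectors xs zero  = [] ∷ []
vectors xs (suc n) = cartesianProductWith _∷_ xs (vectors xs n)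

∈-vectors : ∀ {A : Set} {xs : List A} → (∀ x → x List∈.∈ xs) →
            ∀ {n} (v : Vec A n) → v List∈.∈ vectors xs n
∈-vectors all []      = here refl
∈-vectors all (x ∷ v) = ∈-cartesianProductWith⁺ _∷_ (all x) (∈-vectors all v)

module Scheduling (ℝ : Reals) where

  open Reals ℝ
  private
    module R = CommutativeRing commutativeRing
    module O = IsDecTotalOrder isDecTotalOrder

  IsMaximum : {I : Set} → (I → Carrier) → Carrier → Set
  IsMaximum f v = (∃[ i ] f i ≡ v) × (∀ i → f i ≤ v)

  IsMinimum : {I : Set} → (I → Carrier) → Carrier → Set
  IsMinimum f v = (∃[ i ] f i ≡ v) × (∀ i → v ≤ f i)

  Maximum Minimum : {I : Set} → (I → Carrier) → Set
  Maximum f = ∃ (IsMaximum f)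
  Minimum f = ∃ (IsMinimum f)

  -- I may be infinite, as long as finitely many indices dominate all others.
  maximum : {I : Set} (f : I → Carrier) (x : I) (xs : List I) →
            (∀ i → ∃[ y ] y List∈.∈ xs × f i ≤ f y) → Maximum f
  maximum f x xs dominated = f a , (a , refl) , upper
    where
    open Extrema totalOrder
    a = argmax f x xs
    upper : ∀ i → f i ≤ f a
    upper i with y , y∈xs , fi≤fy ← dominated i =
      O.trans fi≤fy (All.lookup (f[xs]≤f[argmax] x xs) y∈xs)

  minimum : {I : Set} (f : I → Carrier) (x : I) (xs : List I) →
            (∀ i → ∃[ y ] y List∈.∈ xs × f y ≤ f i) → Minimum f
  minimum f x xs dominated = f a , (a , refl) , lower
    where
    open Extrema totalOrder
    a = argmin f x xs
    lower : ∀ i → f a ≤ f i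
    lower i with y , y∈xs , fy≤fi ← dominated i =
      O.trans (All.lookup (f[argmin]≤f[xs] x xs) y∈xs) fy≤fi

  Sizes : ℕ → Set
  Sizes = Vec Carrier

  infix 4 _≤ᵛ_
  _≤ᵛ_ : ∀ {n} → Sizes n → Sizes n → Set
  p ≤ᵛ q = ∀ j → lookup p j ≤ lookup q j

  NonNegative : ∀ {n} → Sizes n → Set
  NonNegative p = ∀ j → 0# ≤ lookup p j

  sumOver : ∀ {n} → Subset n → Sizes n → Carrier
  sumOver A p = sum λ j → if lookup A j then lookup p j else 0#

  load : ∀ {m n} → Schedule m n → Sizes n → Fin m → Carrier
  load S p i = sumOver (Schedule.part S i) p

  makespan-maximum : ∀ {m n} .{{_ : NonZero m}} (S : Schedule m n) (p : Sizes n) →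
                     Maximum (load S p)
  makespan-maximum {suc m} S p = maximum (load S p) zero (allFin (suc m))
    λ i → i , ∈-allFin i , O.refl

  Cmax : ∀ {m n} .{{_ : NonZero m}} → Schedule m n → Sizes n → Carrier
  Cmax S p = proj₁ (makespan-maximum S p)

  InBudgetSet : ∀ {n} → (p⁻ p⁺ : Sizes n) → ℕ → Sizes n → Set
  InBudgetSet {n} p⁻ p⁺ Γ p = ∃[ T ] ∣ T ∣ ℕ.≤ Γ
    × (∀ j → j ∉ T → lookup p j ≡ lookup p⁻ j)
    × (∀ j → j ∈ T → lookup p⁻ j ≤ lookup p j × lookup p j ≤ lookup p⁺ j)

  𝒰 : ∀ {n} → (p⁻ p⁺ : Sizes n) → ℕ → Set
  𝒰 p⁻ p⁺ Γ = ∃ (InBudgetSet p⁻ p⁺ Γ)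

  sum-mono : ∀ {n} {f g : Fin n → Carrier} → (∀ j → f j ≤ g j) → sum f ≤ sum g
  sum-mono {zero} _ = O.refl
  sum-mono {suc n} {f} {g} f≤g = O.trans
    (+-monoʳ-≤ (f zero) (sum-mono λ j → f≤g (suc j)))
    (subst₂ _≤_ (R.+-comm _ (f zero)) (R.+-comm _ (g zero)) (+-monoʳ-≤ _ (f≤g zero)))

  module _ {m n : ℕ} .{{_ : NonZero m}} where

    Cmax-mono : ∀ (S S′ : Schedule m n) (p p′ : Sizes n) →
                (∀ i → load S p i ≤ load S′ p′ i) → Cmax S p ≤ Cmax S′ p′
    Cmax-mono S S′ p p′ le
      with (i , eq) , _ ← proj₂ (makespan-maximum S p)
         | _ , upper ← proj₂ (makespan-maximum S′ p′) =
      O.trans (O.reflexive (sym eq)) (O.trans (le i) (upper i))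

    Cmax-monoʳ : ∀ (S : Schedule m n) (p p′ : Sizes n) → p ≤ᵛ p′ → Cmax S p ≤ Cmax S p′
    Cmax-monoʳ S p p′ p≤p′ = Cmax-mono S S p p′ λ i → sum-mono (term i)
      where
      term : ∀ i j → (if lookup (Schedule.part S i) j then lookup p j else 0#)
                   ≤ (if lookup (Schedule.part S i) j then lookup p′ j else 0#)
      term i j with lookup (Schedule.part S i) j
      ... | true  = p≤p′ j
      ... | false = O.refl

    load-fromTo : ∀ (S : Schedule m n) p i →
                  load (fromAssignment (toAssignment S)) p i ≡ load S p i
    load-fromTo S p i = cong (λ A → sumOver A p)
      (⊆-antisym (part-toFrom S i _) (part-fromTo S i _))

    Cmax-fromTo : ∀ (S : Schedule m n) p →
                  Cmax (fromAssignment (toAssignment S)) p ≡ Cmax S p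
    Cmax-fromTo S p = O.antisym
      (Cmax-mono _ S p p λ i → O.reflexive (load-fromTo S p i))
      (Cmax-mono S _ p p λ i → O.reflexive (sym (load-fromTo S p i)))

  allOnFirst : ∀ m {n} .{{_ : NonZero m}} → Schedule m n
  allOnFirst (suc m) = fromAssignment (replicate _ zero)

  schedules : ∀ m n → List (Schedule m n)
  schedules m n = List.map fromAssignment (vectors (allFin m) n)

  minimum-schedule : ∀ {m n} .{{_ : NonZero m}} (f : Schedule m n → Carrier) →
                     (∀ S → f (fromAssignment (toAssignment S)) ≤ f S) → Minimum f
  minimum-schedule {m} {n} f f-fromTo = minimum f (allOnFirst m) (schedules m n)
    λ S → _ , ∈-map⁺ fromAssignment (∈-vectors ∈-allFin (toAssignment S)) , f-fromTo S

  OPT-minimum : ∀ m {n} .{{_ : NonZero m}} (p : Sizes n) →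
                Minimum (λ (S : Schedule m n) → Cmax S p)
  OPT-minimum m p = minimum-schedule (λ S → Cmax S p) λ S → O.reflexive (Cmax-fromTo S p)

  OPT : ∀ m {n} .{{_ : NonZero m}} → Sizes n → Carrier
  OPT m p = proj₁ (OPT-minimum m p)

  module _ {n : ℕ} (p⁻ p⁺ : Sizes n) (p⁻≤p⁺ : p⁻ ≤ᵛ p⁺) (Γ : ℕ) where

    private
      lower : 𝒰 p⁻ p⁺ Γ
      lower = p⁻ , ⊥ , subst (ℕ._≤ Γ) (sym (∣⊥∣≡0 n)) ℕ.z≤n
                 , (λ _ _ → refl) , λ _ j∈⊥ → ⊥-elim (∉⊥ j∈⊥)

      raise : Subset n → Sizes n
      raise T = tabulate λ j → if does (j ∈? T) then lookup p⁺ j else lookup p⁻ j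

      raise-∉ : ∀ T j → j ∉ T → lookup (raise T) j ≡ lookup p⁻ j
      raise-∉ T j j∉T = trans (lookup∘tabulate _ j) eq
        where
        eq : (if does (j ∈? T) then lookup p⁺ j else lookup p⁻ j) ≡ lookup p⁻ j
        eq with j ∈? T
        ... | yes j∈T = ⊥-elim (j∉T j∈T)
        ... | no _    = refl

      raise-∈ : ∀ T j → j ∈ T → lookup (raise T) j ≡ lookup p⁺ j
      raise-∈ T j j∈T = trans (lookup∘tabulate _ j) eq
        where
        eq : (if does (j ∈? T) then lookup p⁺ j else lookup p⁻ j) ≡ lookup p⁺ j
        eq with j ∈? T
        ... | yes _  = refl
        ... | no j∉T = ⊥-elim (j∉T j∈T)

      vertex′ : (T : Subset n) → Dec (∣ T ∣ ℕ.≤ Γ) → 𝒰 p⁻ p⁺ Γ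
      vertex′ T (no _)  = lower
      vertex′ T (yes h) = raise T , T , h , raise-∉ T , λ j j∈T →
        subst (lookup p⁻ j ≤_) (sym (raise-∈ T j j∈T)) (p⁻≤p⁺ j) ,
        O.reflexive (raise-∈ T j j∈T)

      vertex : Subset n → 𝒰 p⁻ p⁺ Γ
      vertex T = vertex′ T (∣ T ∣ ℕ.≤? Γ)

      vertex-above : ∀ {p} (u : InBudgetSet p⁻ p⁺ Γ p) → p ≤ᵛ proj₁ (vertex (proj₁ u))
      vertex-above {p} (T , h , out , ins) j with ∣ T ∣ ℕ.≤? Γ
      ... | no ¬h = ⊥-elim (¬h h)
      ... | yes _ with j ∈? T
      ...   | yes j∈T = subst (lookup p j ≤_) (sym (raise-∈ T j j∈T)) (proj₂ (ins j j∈T))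
      ...   | no j∉T  = O.reflexive (trans (out j j∉T) (sym (raise-∉ T j j∉T)))

      bools : List Bool
      bools = true ∷ false ∷ []

      ∈-bools : ∀ b → b List∈.∈ bools
      ∈-bools true  = here refl
      ∈-bools false = there (here refl)

    module _ {m : ℕ} .{{_ : NonZero m}} where

      worstCase-maximum : (S : Schedule m n) →
                          Maximum (λ (u : 𝒰 p⁻ p⁺ Γ) → Cmax S (proj₁ u))
      worstCase-maximum S = maximum _ lower (List.map vertex (vectors bools n))
        λ (p , u) → vertex (proj₁ u)
                  , ∈-map⁺ vertex (∈-vectors ∈-bools (proj₁ u))
                  , Cmax-monoʳ S p (proj₁ (vertex (proj₁ u))) (vertex-above {p} u)

      -- max_{p ∈ U_Γ} C_max(S, p)
      worstCase : Schedule m n → Carrier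
      worstCase S = proj₁ (worstCase-maximum S)

      worstCase-fromTo : ∀ S → worstCase (fromAssignment (toAssignment S)) ≤ worstCase S
      worstCase-fromTo S
        with (u , eq) , _ ← proj₂ (worstCase-maximum (fromAssignment (toAssignment S)))
           | _ , upper ← proj₂ (worstCase-maximum S) =
        O.trans (O.reflexive (trans (sym eq) (Cmax-fromTo S (proj₁ u)))) (upper u)

    OPTʳᵒᵇ-minimum : ∀ m .{{_ : NonZero m}} → Minimum (worstCase {m})
    OPTʳᵒᵇ-minimum m = minimum-schedule worstCase worstCase-fromTo

    OPTʳᵒᵇ : ∀ m .{{_ : NonZero m}} → Carrier
    OPTʳᵒᵇ m = proj₁ (OPTʳᵒᵇ-minimum m)

  -- A deterministic algorithm is a function of the instance and the prediction; it
  -- does not see the budget Γ.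
  Algorithm : Set
  Algorithm = (m n : ℕ) .{{_ : NonZero m}} → (p⁻ p⁺ p̂ : Sizes n) → Schedule m n

{-# OPTIONS --safe #-}
-- Split the jobs, independently of Γ and of the prediction, into m parts that cost at
-- most 5 OPTʳᵒᵇ(𝒰_Γ) for every Γ: go through the jobs by decreasing deviation
-- d = p⁺ − p⁻ in blocks of m, and give each part one job of the block, larger p⁻ going to
-- smaller p⁻-load.  The p⁻-loads then differ by at most max p⁻, and the loads with respect
-- to any size e that is increasing in d differ by at most max e.  With Γ θ = OPTʳᵒᵇ, the
-- excess e = (d − θ)⁺ has load at most OPTʳᵒᵇ on each machine of a robust optimum, and Γ
-- raised jobs cost at most Γ θ plus their excess.
--
-- Next put h = OPT(p̂) / 2λ and cut each part into single jobs with p̂ > h, bundles with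
-- h < p̂ ≤ 2h, and one rest with p̂ ≤ h.  Single jobs follow an optimal schedule for p̂,
-- bundles go greedily to machines of p̂-load at most OPT(p̂), and each machine gets one
-- rest, so the p̂-loads are at most OPT(p̂) + 3h.  A machine receives at most 2λ + 2 pieces
-- larger than h, each costing no more than the part it was cut from.
module Submission where

open import Defs
open import Algebra.Bundles using (CommutativeRing)
open import Data.Bool.Base using (Bool; true; false; if_then_else_; _∧_; not)
open import Data.Empty using (⊥-elim)
open import Data.Fin.Base using (Fin; zero; suc; fromℕ<)
import Data.Fin.Properties as Fin
open import Data.Fin.Subset as Subset using (Subset; ∣_∣; ⁅_⁆; ⊥)
import Data.Fin.Subset.Properties as Subset
open import Data.List.Base as List
  using (List; []; _∷_; _++_; [_]; map; concat; concatMap; tabulate; allFin; length; take; drop;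
         replicate)
import Data.List.Properties as List
open import Data.List.Membership.Propositional using (_∈_)
open import Data.List.Membership.Propositional.Properties
  using (∈-allFin; ∈-map⁺; ∈-map⁻; ∈-++⁺ˡ; ∈-++⁻; ∈-concatMap⁻; ∈-lookup)
open import Data.List.Relation.Binary.Permutation.Propositional as ↭
  using (_↭_; ↭-sym; ↭-trans; ↭-refl; ↭⇒↭ₛ)
import Data.List.Relation.Binary.Permutation.Propositional.Properties as ↭
import Data.List.Relation.Binary.Permutation.Setoid.Properties as ↭ₛ
open import Data.List.Relation.Unary.All as All using (All; []; _∷_)
import Data.List.Relation.Unary.All.Properties as All
open import Data.List.Relation.Unary.AllPairs using (AllPairs; []; _∷_)
open import Data.List.Relation.Unary.Any as Any using (here; there)
import Data.List.Relation.Unary.Sorted.TotalOrder.Properties as Sorted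
open import Data.List.Relation.Unary.Unique.Propositional using (Unique)
open import Data.List.Relation.Unary.Unique.Propositional.Properties using (allFin⁺)
import Data.List.Sort as Sort
open import Data.Nat.Base as ℕ using (ℕ; zero; suc; NonZero)
import Data.Nat.Properties as ℕ
open import Data.Product using (Σ; ∃; ∃-syntax; _×_; _,_; proj₁; proj₂)
open import Data.Sum.Base as Sum using (_⊎_; inj₁; inj₂; [_,_]′)
open import Data.Vec.Base as Vec using (lookup; []; _∷_)
open import Data.Vec.Properties using (lookup∘tabulate; []=⇒lookup; lookup⇒[]=)
open import Function.Base using (_∘_; id)
open import Level using (0ℓ)
open import Relation.Binary.Bundles using (DecTotalOrder; Poset)
import Relation.Binary.Construct.Flip.EqAndOrd as Flip
import Relation.Binary.Construct.On as On
open import Relation.Binary.PropositionalEquality hiding ([_])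
open import Relation.Binary.Structures using (IsDecTotalOrder)
open import Relation.Nullary using (¬_; Dec; yes; no; does)
open import Relation.Nullary.Decidable using (_×-dec_)

-- Lists and finite subsets: permutations, sorting, dealing, truncation.

private variable
  A B : Set

unique-value : ∀ {ps : List (A × B)} {x y z} → Unique (map proj₁ ps) →
               (x , y) ∈ ps → (x , z) ∈ ps → y ≡ z
unique-value _         (here refl) (here refl) = refl
unique-value (x∉ ∷ _)  (here refl) (there x∈)  = ⊥-elim (All.lookup x∉ (∈-map⁺ proj₁ x∈) refl)
unique-value (x∉ ∷ _)  (there x∈)  (here refl) = ⊥-elim (All.lookup x∉ (∈-map⁺ proj₁ x∈) refl)
unique-value (_ ∷ ps!) (there x∈)  (there x∈′) = unique-value ps! x∈ x∈′

↭-concat : ∀ {xss yss : List (List A)} → xss ↭ yss → concat xss ↭ concat yss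
↭-concat ↭.refl           = ↭-refl
↭-concat (↭.prep xs p)    = ↭.++⁺ˡ xs (↭-concat p)
↭-concat (↭.swap xs ys p) = ↭-trans (↭.shifts xs ys) (↭.++⁺ˡ ys (↭.++⁺ˡ xs (↭-concat p)))
↭-concat (↭.trans p q)    = ↭-trans (↭-concat p) (↭-concat q)

concatMap-++-↭ : ∀ (f g : A → List B) xs →
                 concatMap (λ x → f x ++ g x) xs ↭ concatMap f xs ++ concatMap g xs
concatMap-++-↭ f g []       = ↭-refl
concatMap-++-↭ f g (x ∷ xs) = begin
  (f x ++ g x) ++ concatMap _ xs                    ↭⟨ ↭.++⁺ˡ _ (concatMap-++-↭ f g xs) ⟩
  (f x ++ g x) ++ concatMap f xs ++ concatMap g xs  ≡⟨ List.++-assoc (f x) _ _ ⟩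
  f x ++ g x ++ concatMap f xs ++ concatMap g xs    ↭⟨ ↭.++⁺ˡ (f x) (↭.shifts (g x) (concatMap f xs)) ⟩
  f x ++ concatMap f xs ++ g x ++ concatMap g xs    ≡⟨ List.++-assoc (f x) _ _ ⟨
  concatMap f (x ∷ xs) ++ concatMap g (x ∷ xs)      ∎
  where open ↭.PermutationReasoning

concatMap-↭ : ∀ {f g : A → List B} → (∀ x → f x ↭ g x) → ∀ xs → concatMap f xs ↭ concatMap g xs
concatMap-↭ f↭g []       = ↭-refl
concatMap-↭ f↭g (x ∷ xs) = ↭.++⁺ (f↭g x) (concatMap-↭ f↭g xs)

concat-concatMap : ∀ (f : A → List (List B)) xs →
                   concat (concatMap f xs) ≡ concatMap (concat ∘ f) xs
concat-concatMap f xs = trans (sym (List.concat-concat (map f xs)))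
  (cong concat (sym (List.map-∘ xs)))

-- Gathers cuts made part by part into one decomposition of all jobs: `f` gives the big jobs, `bs`
-- the bundles and `r` the rest of a part.
concatMap-pieces-↭ : ∀ {f : A → List B} {bs : A → List (List B)} {r g : A → List B} →
  (∀ x → (f x ++ concat (bs x)) ++ r x ↭ g x) → ∀ xs →
  (concatMap f xs ++ concat (concatMap bs xs)) ++ concatMap r xs ↭ concatMap g xs
concatMap-pieces-↭ {f = f} {bs} {r} {g} pieces xs = begin
  (concatMap f xs ++ concat (concatMap bs xs)) ++ concatMap r xs
    ≡⟨ cong (λ l → (concatMap f xs ++ l) ++ concatMap r xs) (concat-concatMap bs xs) ⟩
  (concatMap f xs ++ concatMap (concat ∘ bs) xs) ++ concatMap r xs
    ↭⟨ ↭.++⁺ʳ (concatMap r xs) (concatMap-++-↭ f (concat ∘ bs) xs) ⟨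
  concatMap (λ x → f x ++ concat (bs x)) xs ++ concatMap r xs
    ↭⟨ concatMap-++-↭ _ r xs ⟨
  concatMap (λ x → (f x ++ concat (bs x)) ++ r x) xs
    ↭⟨ concatMap-↭ pieces xs ⟩
  concatMap g xs ∎
  where open ↭.PermutationReasoning

-- The rearrangement behind `cut-↭` at the moment when `x` and the open rest `ys` are closed as a
-- new bundle, which leaves an empty rest.
close-↭ : ∀ (x : A) xs ys zs → (xs ++ x ∷ ys ++ zs) ++ [] ↭ x ∷ (xs ++ zs) ++ ys
close-↭ x xs ys zs = begin
  (xs ++ x ∷ ys ++ zs) ++ []  ≡⟨ List.++-identityʳ _ ⟩
  xs ++ (x ∷ ys) ++ zs        ↭⟨ ↭.shifts xs (x ∷ ys) ⟩
  x ∷ ys ++ xs ++ zs          ↭⟨ ↭.prep x (↭.++-comm ys _) ⟩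
  x ∷ (xs ++ zs) ++ ys        ∎
  where open ↭.PermutationReasoning

-- Turns the placement of a bundle on a machine into placements of its single jobs.
spread : List A × B → List (A × B)
spread (xs , y) = map (_, y) xs

map-proj₁-spread : ∀ (xs : List A) (y : B) → map proj₁ (spread (xs , y)) ≡ xs
map-proj₁-spread []       y = refl
map-proj₁-spread (x ∷ xs) y = cong (x ∷_) (map-proj₁-spread xs y)

map-proj₁-spreads : ∀ (ps : List (List A × B)) →
                    map proj₁ (concatMap spread ps) ≡ concat (map proj₁ ps)
map-proj₁-spreads []             = refl
map-proj₁-spreads ((xs , y) ∷ ps) = trans (List.map-++ proj₁ (spread (xs , y)) _)
  (cong₂ _++_ (map-proj₁-spread xs y) (map-proj₁-spreads ps))

sortOn : (D : DecTotalOrder 0ℓ 0ℓ 0ℓ) (f : A → DecTotalOrder.Carrier D) → ∀ xs →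
         ∃[ ys ] ys ↭ xs × AllPairs (λ x y → DecTotalOrder._≤_ D (f x) (f y)) ys
sortOn D f xs = sort xs , sort-↭ xs , Sorted.Sorted⇒AllPairs (DecTotalOrder.totalOrder D′) (sort-↗ xs)
  where
  D′ = On.decTotalOrder D f
  open Sort D′

AllPairs-++⁻ : ∀ {R : A → A → Set} xs {ys} → AllPairs R (xs ++ ys) →
               AllPairs R ys × (∀ {x y} → x ∈ xs → y ∈ ys → R x y)
AllPairs-++⁻ []       Rys         = Rys , λ ()
AllPairs-++⁻ (x ∷ xs) (Rx ∷ Rxsys) with Rys , Rxy ← AllPairs-++⁻ xs Rxsys =
  Rys , λ { (here refl) y∈ → All.lookup (All.++⁻ʳ xs Rx) y∈ ; (there x∈) y∈ → Rxy x∈ y∈ }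

-- If the bins run out, the remaining elements are dropped; `deal-↭` excludes this by its bound on
-- the lengths.
deal : List A → List (List A) → List (List A)
deal []       bs       = bs
deal (q ∷ qs) []       = []
deal (q ∷ qs) (b ∷ bs) = (q ∷ b) ∷ deal qs bs

length-deal : ∀ (qs : List A) bs → length (deal qs bs) ≡ length bs
length-deal []       bs       = refl
length-deal (q ∷ qs) []       = refl
length-deal (q ∷ qs) (b ∷ bs) = cong suc (length-deal qs bs)

deal-↭ : ∀ (qs : List A) bs → length qs ℕ.≤ length bs → concat (deal qs bs) ↭ qs ++ concat bs
deal-↭ []       bs       _           = ↭-refl
deal-↭ (q ∷ qs) (b ∷ bs) (ℕ.s≤s len) = ↭.prep q
  (↭-trans (↭.++⁺ˡ b (deal-↭ qs bs len)) (↭.shifts b qs))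

-- `unchanged` carries the strict inequality so that a block with as many jobs as there are bins
-- rules it out.
data Dealt (x : List A) (qs : List A) (bs : List (List A)) : Set where
  unchanged : length qs ℕ.< length bs → x ∈ bs → Dealt x qs bs
  extended  : ∀ {q b} → q ∈ qs → b ∈ bs → x ≡ q ∷ b → Dealt x qs bs

deal-∈ : ∀ {x : List A} qs bs → x ∈ deal qs bs → Dealt x qs bs
deal-∈ []       (b ∷ bs) x∈          = unchanged (ℕ.s≤s ℕ.z≤n) x∈
deal-∈ (q ∷ qs) (b ∷ bs) (here refl) = extended (here refl) (here refl) refl
deal-∈ (q ∷ qs) (b ∷ bs) (there x∈) with deal-∈ qs bs x∈
... | unchanged lt x∈bs  = unchanged (ℕ.s≤s lt) (there x∈bs)
... | extended q∈ b∈ eq  = extended (there q∈) (there b∈) eq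

-- `excess-load` splits on the final alternative: the whole of `G` fits into the budget, or `T` uses
-- the budget up exactly.
truncate : ∀ {n} Γ (G : Subset n) → ∃[ T ] T Subset.⊆ G × ∣ T ∣ ℕ.≤ Γ × (T ≡ G ⊎ ∣ T ∣ ≡ Γ)
truncate {n} zero G = ⊥ , ⊥-elim ∘ Subset.∉⊥ , ℕ.≤-reflexive (Subset.∣⊥∣≡0 n) , inj₂ (Subset.∣⊥∣≡0 n)
truncate (suc Γ) [] = [] , id , ℕ.z≤n , inj₁ refl
truncate (suc Γ) (true ∷ G) with T , T⊆G , ∣T∣≤Γ , max ← truncate Γ G =
  true ∷ T , Subset.s⊆s T⊆G , ℕ.s≤s ∣T∣≤Γ , Sum.map (cong (true ∷_)) (cong suc) max
truncate (suc Γ) (false ∷ G) with T , T⊆G , ∣T∣≤Γ , max ← truncate (suc Γ) G =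
  false ∷ T , Subset.s⊆s T⊆G , ∣T∣≤Γ , Sum.map (cong (false ∷_)) id max

0<∣T∣⇒nonempty : ∀ {n} (T : Subset n) → 0 ℕ.< ∣ T ∣ → Subset.Nonempty T
0<∣T∣⇒nonempty {n} T 0<∣T∣ with Subset.nonempty? T
... | yes ∃j = ∃j
... | no ¬∃j = ⊥-elim (ℕ.<⇒≢ 0<∣T∣ (sym (trans (cong ∣_∣ (Subset.Empty-unique ¬∃j)) (Subset.∣⊥∣≡0 n))))

-- Arithmetic in an ordered field.

module OrderedField (ℝ : Reals) where

  open Reals ℝ public
  module R = CommutativeRing commutativeRing
  module O = IsDecTotalOrder isDecTotalOrder
  open import Algebra.Solver.Ring.NaturalCoefficients.Default R.commutativeSemiring public
    using (Polynomial; solve; con; _:+_; _:*_; _:=_)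
  ≤-poset : Poset 0ℓ 0ℓ 0ℓ
  ≤-poset = record { isPartialOrder = O.isPartialOrder }

  open import Relation.Binary.Reasoning.PartialOrder ≤-poset public

  -- The solver reads con k as 1# + ⋯ + 1#, whereas fromℕ k ends in + 0#.
  nat : ∀ {n} → ℕ → Polynomial n
  nat zero    = con 0
  nat (suc k) = con 1 :+ nat k

  +-monoˡ-≤ : ∀ z {x y} → x ≤ y → x + z ≤ y + z
  +-monoˡ-≤ z x≤y = subst₂ _≤_ (R.+-comm z _) (R.+-comm z _) (+-monoʳ-≤ z x≤y)

  +-mono-≤ : ∀ {x y u v} → x ≤ y → u ≤ v → x + u ≤ y + v
  +-mono-≤ x≤y u≤v = O.trans (+-monoˡ-≤ _ x≤y) (+-monoʳ-≤ _ u≤v)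

  +-nonNegative : ∀ {x y} → 0# ≤ x → 0# ≤ y → 0# ≤ x + y
  +-nonNegative 0≤x 0≤y = subst (_≤ _) (R.+-identityˡ 0#) (+-mono-≤ 0≤x 0≤y)

  x≤x+y : ∀ {x y} → 0# ≤ y → x ≤ x + y
  x≤x+y {x} {y} 0≤y = subst (_≤ x + y) (R.+-identityʳ x) (+-monoʳ-≤ x 0≤y)

  x≤y+x : ∀ {x y} → 0# ≤ y → x ≤ y + x
  x≤y+x {x} {y} 0≤y = subst (x ≤_) (R.+-comm x y) (x≤x+y 0≤y)

  z+x-z≡x : ∀ z x → - z + (z + x) ≡ x
  z+x-z≡x z x = trans (sym (R.+-assoc (- z) z x))
    (trans (cong (_+ x) (R.-‿inverseˡ z)) (R.+-identityˡ x))

  x+[y-x]≡y : ∀ x y → x + (y + - x) ≡ y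
  x+[y-x]≡y x y = trans (cong (x +_) (R.+-comm y (- x)))
    (trans (sym (R.+-assoc x (- x) y))
      (trans (cong (_+ y) (R.-‿inverseʳ x)) (R.+-identityˡ y)))

  +-cancelˡ-≤ : ∀ z {x y} → z + x ≤ z + y → x ≤ y
  +-cancelˡ-≤ z le = subst₂ _≤_ (z+x-z≡x z _) (z+x-z≡x z _) (+-monoʳ-≤ (- z) le)

  x≤y⇒0≤y-x : ∀ {x y} → x ≤ y → 0# ≤ y + - x
  x≤y⇒0≤y-x {x} x≤y = subst (_≤ _) (R.-‿inverseʳ x) (+-monoˡ-≤ (- x) x≤y)

  ≰⇒< : ∀ {x y} → ¬ x ≤ y → y < x
  ≰⇒< {x} {y} x≰y with O.total x y
  ... | inj₁ x≤y = ⊥-elim (x≰y x≤y)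
  ... | inj₂ y≤x = y≤x , λ { refl → x≰y O.refl }

  <⇒≱ : ∀ {x y} → x < y → ¬ y ≤ x
  <⇒≱ (x≤y , x≢y) y≤x = x≢y (O.antisym x≤y y≤x)

  *-monoˡ-≤ : ∀ {x y z} → 0# ≤ z → x ≤ y → z * x ≤ z * y
  *-monoˡ-≤ {x} {y} {z} 0≤z x≤y = begin
    z * x                   ≤⟨ x≤x+y (*-nonNegative 0≤z (x≤y⇒0≤y-x x≤y)) ⟩
    z * x + z * (y + - x)   ≡⟨ R.distribˡ z x _ ⟨
    z * (x + (y + - x))     ≡⟨ cong (z *_) (x+[y-x]≡y x y) ⟩
    z * y                   ∎

  *-monoʳ-≤ : ∀ {x y z} → 0# ≤ z → x ≤ y → x * z ≤ y * z
  *-monoʳ-≤ {z = z} 0≤z x≤y = subst₂ _≤_ (R.*-comm z _) (R.*-comm z _) (*-monoˡ-≤ 0≤z x≤y)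

  -- If 1 ≤ 0 then 0 ≤ -1, and 1 is the square of -1.
  0≤1 : 0# ≤ 1#
  0≤1 with O.total 0# 1#
  ... | inj₁ 0≤1 = 0≤1
  ... | inj₂ 1≤0 = subst (0# ≤_) [-1]*[-1]≡1 (*-nonNegative 0≤-1 0≤-1)
    where
    open import Algebra.Properties.Ring R.ring using (-1*x≈-x)
    open import Algebra.Properties.AbelianGroup R.+-abelianGroup using (⁻¹-involutive)
    0≤-1 : 0# ≤ - 1#
    0≤-1 = subst (0# ≤_) (R.+-identityˡ _) (x≤y⇒0≤y-x 1≤0)
    [-1]*[-1]≡1 : - 1# * - 1# ≡ 1#
    [-1]*[-1]≡1 = trans (-1*x≈-x (- 1#)) (⁻¹-involutive 1#)

  0<1 : 0# < 1#
  0<1 = 0≤1 , 0≢1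

  fromℕ-nonNegative : ∀ k → 0# ≤ fromℕ k
  fromℕ-nonNegative zero    = O.refl
  fromℕ-nonNegative (suc k) = +-nonNegative 0≤1 (fromℕ-nonNegative k)

  0<1+x : ∀ {x} → 0# ≤ x → 0# < 1# + x
  0<1+x 0≤x = ≰⇒< λ 1+x≤0 → <⇒≱ 0<1 (O.trans (x≤x+y 0≤x) 1+x≤0)

  ⁻¹-nonNegative : ∀ {x} → 0# < x → 0# ≤ x ⁻¹
  ⁻¹-nonNegative {x} (0≤x , 0≢x) with O.total 0# (x ⁻¹)
  ... | inj₁ 0≤x⁻¹ = 0≤x⁻¹
  ... | inj₂ x⁻¹≤0 = ⊥-elim (<⇒≱ 0<1 (begin
    1#        ≡⟨ *-inverseʳ x (0≢x ∘ sym) ⟨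
    x * x ⁻¹  ≤⟨ *-monoˡ-≤ 0≤x x⁻¹≤0 ⟩
    x * 0#    ≡⟨ R.zeroʳ x ⟩
    0#        ∎))

  x*[x⁻¹*y]≡y : ∀ {x} y → 0# < x → x * (x ⁻¹ * y) ≡ y
  x*[x⁻¹*y]≡y {x} y (_ , 0≢x) = trans (sym (R.*-assoc x _ y))
    (trans (cong (_* y) (*-inverseʳ x (0≢x ∘ sym))) (R.*-identityˡ y))

  *-cancelˡ-≤ : ∀ {x y z} → 0# < z → z * x ≤ z * y → x ≤ y
  *-cancelˡ-≤ {x} {y} {z} 0<z le = subst₂ _≤_ (eq x) (eq y) (*-monoˡ-≤ (⁻¹-nonNegative 0<z) le)
    where
    eq : ∀ x → z ⁻¹ * (z * x) ≡ x
    eq x = trans (solve 3 (λ a b c → a :* (b :* c) := b :* (a :* c)) refl (z ⁻¹) z x)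
                 (x*[x⁻¹*y]≡y x 0<z)

  *-pos : ∀ {x y} → 0# < x → 0# < y → 0# < x * y
  *-pos {x} {y} 0<x 0<y = ≰⇒< λ xy≤0 →
    <⇒≱ 0<y (*-cancelˡ-≤ 0<x (subst (x * y ≤_) (sym (R.zeroʳ x)) xy≤0))

  infix 8 [_]·_
  [_]·_ : Bool → Carrier → Carrier
  [ b ]· x = if b then x else 0#

  []·-nonNegative : ∀ b {x} → 0# ≤ x → 0# ≤ [ b ]· x
  []·-nonNegative true  0≤x = 0≤x
  []·-nonNegative false _   = O.refl

  []·-mono : ∀ b {x y} → x ≤ y → [ b ]· x ≤ [ b ]· y
  []·-mono true  x≤y = x≤y
  []·-mono false _   = O.refl

  *-[]· : ∀ c b x → c * ([ b ]· x) ≡ [ b ]· (c * x)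
  *-[]· c true  x = refl
  *-[]· c false x = R.zeroʳ c

  -- Finite sums over lists.

  ∑ : List A → (A → Carrier) → Carrier
  ∑ []       f = 0#
  ∑ (x ∷ xs) f = f x + ∑ xs f

  ∑-cong : ∀ {f g : A → Carrier} xs → (∀ {x} → x ∈ xs → f x ≡ g x) → ∑ xs f ≡ ∑ xs g
  ∑-cong []       f≡g = refl
  ∑-cong (x ∷ xs) f≡g = cong₂ _+_ (f≡g (here refl)) (∑-cong xs (f≡g ∘ there))

  ∑-mono : ∀ {f g : A → Carrier} xs → (∀ {x} → x ∈ xs → f x ≤ g x) → ∑ xs f ≤ ∑ xs g
  ∑-mono []       f≤g = O.refl
  ∑-mono (x ∷ xs) f≤g = +-mono-≤ (f≤g (here refl)) (∑-mono xs (f≤g ∘ there))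

  ∑-zero : (xs : List A) → ∑ xs (λ _ → 0#) ≡ 0#
  ∑-zero []       = refl
  ∑-zero (x ∷ xs) = trans (R.+-identityˡ _) (∑-zero xs)

  ∑-nonNegative : ∀ {f : A → Carrier} xs → (∀ x → 0# ≤ f x) → 0# ≤ ∑ xs f
  ∑-nonNegative {f = f} xs 0≤f = subst (_≤ ∑ xs f) (∑-zero xs) (∑-mono xs λ {x} _ → 0≤f x)

  ∑-++ : ∀ (f : A → Carrier) xs ys → ∑ (xs ++ ys) f ≡ ∑ xs f + ∑ ys f
  ∑-++ f []       ys = sym (R.+-identityˡ _)
  ∑-++ f (x ∷ xs) ys = trans (cong (f x +_) (∑-++ f xs ys)) (sym (R.+-assoc _ _ _))

  ∑-map : ∀ (f : B → Carrier) (g : A → B) xs → ∑ (map g xs) f ≡ ∑ xs (f ∘ g)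
  ∑-map f g []       = refl
  ∑-map f g (x ∷ xs) = cong (f (g x) +_) (∑-map f g xs)

  ∑-concat : ∀ (f : A → Carrier) xss → ∑ (concat xss) f ≡ ∑ xss (λ xs → ∑ xs f)
  ∑-concat f []         = refl
  ∑-concat f (xs ∷ xss) = trans (∑-++ f xs (concat xss)) (cong (∑ xs f +_) (∑-concat f xss))

  ∑-↭ : ∀ (f : A → Carrier) {xs ys} → xs ↭ ys → ∑ xs f ≡ ∑ ys f
  ∑-↭ f ↭.refl          = refl
  ∑-↭ f (↭.prep x p)    = cong (f x +_) (∑-↭ f p)
  ∑-↭ f (↭.swap x y p)  = trans
    (solve 3 (λ a b c → a :+ (b :+ c) := b :+ (a :+ c)) refl (f x) (f y) _)
    (cong (λ s → f y + (f x + s)) (∑-↭ f p))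
  ∑-↭ f (↭.trans p q)   = trans (∑-↭ f p) (∑-↭ f q)

  ∑-distrib-+ : ∀ (f g : A → Carrier) xs → ∑ xs (λ x → f x + g x) ≡ ∑ xs f + ∑ xs g
  ∑-distrib-+ f g []       = sym (R.+-identityˡ 0#)
  ∑-distrib-+ f g (x ∷ xs) = trans (cong (f x + g x +_) (∑-distrib-+ f g xs))
    (solve 4 (λ a b c d → a :+ b :+ (c :+ d) := a :+ c :+ (b :+ d)) refl (f x) (g x) _ _)

  ∑-distribˡ-* : ∀ c (f : A → Carrier) xs → ∑ xs (λ x → c * f x) ≡ c * ∑ xs f
  ∑-distribˡ-* c f []       = sym (R.zeroʳ c)
  ∑-distribˡ-* c f (x ∷ xs) = trans (cong (c * f x +_) (∑-distribˡ-* c f xs)) (sym (R.distribˡ c _ _))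

  ∑-comm : ∀ (f : A → B → Carrier) xs ys →
           ∑ xs (λ x → ∑ ys (f x)) ≡ ∑ ys (λ y → ∑ xs λ x → f x y)
  ∑-comm f []       ys = sym (∑-zero ys)
  ∑-comm f (x ∷ xs) ys = trans (cong (∑ ys (f x) +_) (∑-comm f xs ys)) (sym (∑-distrib-+ (f x) _ ys))

  ≤-∑ : ∀ {f : A → Carrier} {x xs} → (∀ x → 0# ≤ f x) → x ∈ xs → f x ≤ ∑ xs f
  ≤-∑ {xs = _ ∷ xs} 0≤f (here refl) = x≤x+y (∑-nonNegative xs 0≤f)
  ≤-∑ {xs = y ∷ _}  0≤f (there x∈)  = O.trans (≤-∑ 0≤f x∈) (x≤y+x (0≤f y))

  ∑-∈-concat : ∀ {f : A → Carrier} {xs xss} → (∀ x → 0# ≤ f x) → xs ∈ xss →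
               ∑ xs f ≤ ∑ (concat xss) f
  ∑-∈-concat {f = f} {xss = xss} 0≤f xs∈xss = subst (_ ≤_) (sym (∑-concat f xss))
    (≤-∑ {f = λ xs → ∑ xs f} (λ xs → ∑-nonNegative xs 0≤f) xs∈xss)

  ∑-⊆ : ∀ {f : A → Carrier} xs ys zs {us} → (∀ x → 0# ≤ f x) →
        (xs ++ ys) ++ zs ↭ us →
        ∑ xs f ≤ ∑ us f × ∑ ys f ≤ ∑ us f × ∑ zs f ≤ ∑ us f
  ∑-⊆ {f = f} xs ys zs {us} 0≤f p =
      O.trans (x≤x+y (∑-nonNegative ys 0≤f)) xs+ys≤
    , O.trans (x≤y+x (∑-nonNegative xs 0≤f)) xs+ys≤
    , O.trans (x≤y+x (+-nonNegative (∑-nonNegative xs 0≤f) (∑-nonNegative ys 0≤f)))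
              (O.reflexive eq)
    where
    eq : (∑ xs f + ∑ ys f) + ∑ zs f ≡ ∑ us f
    eq = trans (cong (_+ ∑ zs f) (sym (∑-++ f xs ys)))
           (trans (sym (∑-++ f (xs ++ ys) zs)) (∑-↭ f p))
    xs+ys≤ : ∑ xs f + ∑ ys f ≤ ∑ us f
    xs+ys≤ = O.trans (x≤x+y (∑-nonNegative zs 0≤f)) (O.reflexive eq)

  -- While the head exceeds `a`, removing it together with one copy of `a` keeps the inequality, and
  -- a single remaining element cannot exceed `a`. The membership makes the list nonempty.
  ∑-average : ∀ (f : A → Carrier) a {x xs} → x ∈ xs →
              ∑ xs f ≤ ∑ xs (λ _ → a) → ∃[ y ] f y ≤ a
  ∑-average f a {xs = x ∷ xs} _ le with f x O.≤? a
  ... | yes fx≤a = x , fx≤a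
  ∑-average f a {xs = x ∷ []}     _ le | no fx≰a = ⊥-elim (fx≰a
    (subst₂ _≤_ (R.+-identityʳ _) (R.+-identityʳ a) le))
  ∑-average f a {xs = x ∷ y ∷ ys} _ le | no fx≰a = ∑-average f a (here {xs = ys} refl)
    (+-cancelˡ-≤ a (begin
      a + ∑ (y ∷ ys) f           ≤⟨ +-monoˡ-≤ _ (proj₁ (≰⇒< fx≰a)) ⟩
      f x + ∑ (y ∷ ys) f         ≤⟨ le ⟩
      a + ∑ (y ∷ ys) (λ _ → a)   ∎))

  ∑-[]· : ∀ b (f : A → Carrier) xs → ∑ xs (λ x → [ b ]· f x) ≡ [ b ]· ∑ xs f
  ∑-[]· true  f xs = refl
  ∑-[]· false f xs = ∑-zero xs

  ∑-tabulate : ∀ {n} (f : A → Carrier) (g : Fin n → A) → ∑ (tabulate g) f ≡ sum (f ∘ g)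
  ∑-tabulate {n = zero}  f g = refl
  ∑-tabulate {n = suc n} f g = cong (f (g zero) +_) (∑-tabulate f (g ∘ suc))

  ∑-allFin : ∀ {n} (f : Fin n → Carrier) → ∑ (allFin n) f ≡ sum f
  ∑-allFin f = ∑-tabulate f id

  ∑-concatMap : ∀ (f : B → Carrier) (g : A → List B) xs →
                ∑ (concatMap g xs) f ≡ ∑ xs (λ x → ∑ (g x) f)
  ∑-concatMap f g xs = trans (∑-concat f (map g xs)) (∑-map _ g xs)

  ∑-indicator : ∀ {n} (f : Fin n → Carrier) k → ∑ (allFin n) (λ i → [ does (k Fin.≟ i) ]· f i) ≡ f k
  ∑-indicator f k = trans (∑-allFin λ i → [ does (k Fin.≟ i) ]· f i) (go f k)
    where
    sum-zero : ∀ n → sum {n} (λ _ → 0#) ≡ 0#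
    sum-zero zero    = refl
    sum-zero (suc n) = trans (R.+-identityˡ _) (sum-zero n)
    go : ∀ {n} (f : Fin n → Carrier) k → sum (λ i → [ does (k Fin.≟ i) ]· f i) ≡ f k
    go {suc n} f zero    = trans (cong (f zero +_) (sum-zero n)) (R.+-identityʳ _)
    go {suc n} f (suc k) = trans (R.+-identityˡ _) (go (f ∘ suc) k)

  ∑-indicatorˡ : ∀ {n} (f : Fin n → Carrier) k → ∑ (allFin n) (λ i → [ does (i Fin.≟ k) ]· f i) ≡ f k
  ∑-indicatorˡ {n} f k = trans
    (∑-cong (allFin n) λ {i} _ → cong ([_]· f i) (does-≟-sym i k)) (∑-indicator f k)
    where
    does-≟-sym : ∀ (i k : Fin n) → does (i Fin.≟ k) ≡ does (k Fin.≟ i)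
    does-≟-sym i k with i Fin.≟ k | k Fin.≟ i
    ... | yes _   | yes _   = refl
    ... | no _    | no _    = refl
    ... | yes i≡k | no k≢i  = ⊥-elim (k≢i (sym i≡k))
    ... | no i≢k  | yes k≡i = ⊥-elim (i≢k (sym k≡i))

-- Cutting the parts into pieces and placing the pieces on machines.

module Refinement (ℝ : Reals) where

  open OrderedField ℝ
  open Scheduling ℝ

  -- The items are abstract because both single jobs and bundles of jobs get placed.
  machineLoad : ∀ {m} → (A → Carrier) → List (A × Fin m) → Fin m → Carrier
  machineLoad w L i = ∑ L λ (a , k) → [ does (k Fin.≟ i) ]· w a

  ∑-machineLoad : ∀ {m} (w : A → Carrier) (L : List (A × Fin m)) →
                  ∑ (allFin m) (machineLoad w L) ≡ ∑ (map proj₁ L) w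
  ∑-machineLoad {m = m} w L = trans (sym (∑-comm _ L (allFin m)))
    (trans (∑-cong L (λ {(a , k)} _ → ∑-indicator (λ _ → w a) k)) (sym (∑-map w proj₁ L)))

  module _ {m n : ℕ} where

    load-∑ : (S : Schedule m n) (p : Sizes n) (i : Fin m) →
             load S p i ≡ ∑ (allFin n) λ j → [ lookup (Schedule.part S i) j ]· lookup p j
    load-∑ S p i = sym (∑-allFin λ j → [ lookup (Schedule.part S i) j ]· lookup p j)

    -- Every job lies in some part, so its weight is one of the nonnegative terms that belong to it
    -- once the sums are exchanged.
    ∑-≤-parts : (S : Schedule m n) {w : Fin n → Carrier} → (∀ j → 0# ≤ w j) →
                ∑ (allFin n) w ≤
                ∑ (allFin m) λ i → ∑ (allFin n) λ j → [ lookup (Schedule.part S i) j ]· w j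
    ∑-≤-parts S {w} 0≤w = begin
      ∑ (allFin n) w
        ≤⟨ ∑-mono (allFin n) (λ {j} _ → le j) ⟩
      ∑ (allFin n) (λ j → ∑ (allFin m) λ i → [ lookup (part i) j ]· w j)
        ≡⟨ ∑-comm _ (allFin n) (allFin m) ⟩
      ∑ (allFin m) (λ i → ∑ (allFin n) λ j → [ lookup (part i) j ]· w j) ∎
      where
      open Schedule S
      le : ∀ j → w j ≤ ∑ (allFin m) λ i → [ lookup (part i) j ]· w j
      le j with i , j∈i ← covers j = begin
        w j                        ≡⟨ cong ([_]· w j) ([]=⇒lookup j∈i) ⟨
        [ lookup (part i) j ]· w j
          ≤⟨ ≤-∑ {f = λ i → [ lookup (part i) j ]· w j}
                 (λ i → []·-nonNegative (lookup (part i) j) (0≤w j)) (∈-allFin i) ⟩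
        ∑ (allFin m) (λ i → [ lookup (part i) j ]· w j) ∎

    -- Each job occurs exactly once as a key, so the list is the graph of a function `σ`, and loads
    -- can be computed on the list itself.
    schedule : (ps : List (Fin n × Fin m)) → map proj₁ ps ↭ allFin n →
               ∃[ S ] ∀ p i → load S p i ≡ machineLoad (lookup p) ps i
    schedule ps ps↭ = fromAssignment (Vec.tabulate σ) , λ p i → begin-equality
      load S p i
        ≡⟨ load-∑ S p i ⟩
      ∑ (allFin n) (λ j → [ lookup (Schedule.part S i) j ]· lookup p j)
        ≡⟨ ∑-cong (allFin n) (λ {j} _ → cong ([_]· lookup p j) (part-σ i j)) ⟩
      ∑ (allFin n) (λ j → [ does (σ j Fin.≟ i) ]· lookup p j)
        ≡⟨ ∑-↭ _ ps↭ ⟨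
      ∑ (map proj₁ ps) (λ j → [ does (σ j Fin.≟ i) ]· lookup p j)
        ≡⟨ ∑-map _ proj₁ ps ⟩
      ∑ ps (λ (j , _) → [ does (σ j Fin.≟ i) ]· lookup p j)
        ≡⟨ ∑-cong ps (λ {(j , _)} x∈ → cong (λ k → [ does (k Fin.≟ i) ]· lookup p j) (σ-unique x∈)) ⟩
      machineLoad (lookup p) ps i ∎
      where
      σ∈ : ∀ j → ∃[ k ] (j , k) ∈ ps
      σ∈ j with (j′ , k) , x∈ , refl ← ∈-map⁻ proj₁ (↭.∈-resp-↭ (↭-sym ps↭) (∈-allFin j)) = k , x∈
      σ : Fin n → Fin m
      σ = proj₁ ∘ σ∈
      S : Schedule m n
      S = fromAssignment (Vec.tabulate σ)
      part-σ : ∀ i j → lookup (Schedule.part S i) j ≡ does (σ j Fin.≟ i)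
      part-σ i j = trans (lookup∘tabulate _ j)
        (cong (λ k → does (k Fin.≟ i)) (lookup∘tabulate σ j))
      σ-unique : ∀ {j k} → (j , k) ∈ ps → σ j ≡ k
      σ-unique {j} = unique-value
        (↭ₛ.Unique-resp-↭ (setoid (Fin n)) (↭⇒↭ₛ (↭-sym ps↭)) (allFin⁺ n)) (proj₂ (σ∈ j))

  -- Greedy list scheduling on top of a placement `L₀`: the total weight is at most `P` per machine
  -- on average, so some machine always has load at most `P`, and an item of weight at most `t`
  -- lifts it to at most `P + t`. The given machine makes the average meaningful.
  listSchedule : ∀ {m} → Fin m → (w : A → Carrier) → ∀ {P t} → 0# ≤ t → (L₀ : List (A × Fin m)) →
    (∀ i → machineLoad w L₀ i ≤ P) →
    (as : List A) → (∀ {a} → a ∈ as → 0# ≤ w a × w a ≤ t) →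
    ∑ (as ++ map proj₁ L₀) w ≤ ∑ (allFin m) (λ _ → P) →
    ∃[ L ] map proj₁ L ≡ as ++ map proj₁ L₀ × (∀ i → machineLoad w L i ≤ P + t)
  listSchedule _ w 0≤t L₀ L₀≤P [] _ _ = L₀ , refl , λ i → O.trans (L₀≤P i) (x≤x+y 0≤t)
  listSchedule {m = m} i₀ w {P} {t} 0≤t L₀ L₀≤P (a ∷ as) w≤t total≤
    with L , eq , L≤ ← listSchedule i₀ w 0≤t L₀ L₀≤P as (w≤t ∘ there)
                         (O.trans (x≤y+x (proj₁ (w≤t (here refl)))) total≤)
    -- The average is taken over the loads before `a` is placed; they sum to no more than the full
    -- total because `w a` is nonnegative.
    with k , k≤P ← ∑-average (machineLoad w L) P (∈-allFin i₀) (begin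
           ∑ (allFin m) (machineLoad w L)           ≡⟨ ∑-machineLoad w L ⟩
           ∑ (map proj₁ L) w                        ≡⟨ cong (λ l → ∑ l w) eq ⟩
           ∑ (as ++ map proj₁ L₀) w                 ≤⟨ x≤y+x (proj₁ (w≤t (here refl))) ⟩
           ∑ (a ∷ as ++ map proj₁ L₀) w             ≤⟨ total≤ ⟩
           ∑ (allFin m) (λ _ → P)                   ∎)
    = (a , k) ∷ L , cong (a ∷_) eq , bound
    where
    bound : ∀ i → machineLoad w ((a , k) ∷ L) i ≤ P + t
    bound i with k Fin.≟ i
    ... | yes refl = subst (w a + machineLoad w L k ≤_) (R.+-comm t P)
                       (+-mono-≤ (proj₂ (w≤t (here refl))) k≤P)
    ... | no _     = subst (_≤ P + t) (sym (R.+-identityˡ _)) (L≤ i)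

  machineLoad-spread : ∀ {m} (f : A → Carrier) (L : List (List A × Fin m)) i →
                       machineLoad f (concatMap spread L) i ≡ machineLoad (λ b → ∑ b f) L i
  machineLoad-spread f L i = trans (∑-concatMap _ spread L)
    (∑-cong L λ {(b , k)} _ → trans (∑-map _ (_, k) b) (∑-[]· (does (k Fin.≟ i)) f b))

  -- Every item on machine i uses more than h of its w-load c * h, so there are at most c of
  -- them; if h = 0 then all w-loads vanish and there are none.
  machineLoad-count : ∀ {m} {v w : A → Carrier} {h c C} (L : List (A × Fin m)) →
    0# ≤ h → 0# ≤ c → 0# ≤ C → (∀ a → 0# ≤ w a) →
    (∀ {a} → a ∈ map proj₁ L → h < w a) → (∀ {a} → a ∈ map proj₁ L → v a ≤ C) →
    (∀ i → machineLoad w L i ≤ c * h) → ∀ i → machineLoad v L i ≤ c * C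
  machineLoad-count {m = m} {v} {w} {h} {c} {C} L 0≤h 0≤c 0≤C 0≤w h<w v≤C w-load i with 0# O.≟ h
  ... | no 0≢h = begin
    machineLoad v L i
      ≤⟨ ∑-mono L (λ {(a , k)} x∈ → []·-mono (does (k Fin.≟ i)) (v≤C (∈-map⁺ proj₁ x∈))) ⟩
    ∑ L (λ (_ , k) → [ does (k Fin.≟ i) ]· C)
      ≡⟨ scaled C ⟩
    C * N                                   ≤⟨ *-monoˡ-≤ 0≤C N≤c ⟩
    C * c                                   ≡⟨ R.*-comm C c ⟩
    c * C                                   ∎
    where
    N : Carrier
    N = ∑ L λ (_ , k) → [ does (k Fin.≟ i) ]· 1#
    scaled : ∀ x → ∑ L (λ (_ , k) → [ does (k Fin.≟ i) ]· x) ≡ x * N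
    scaled x = trans
      (∑-cong L λ {(_ , k)} _ → trans (cong ([ does (k Fin.≟ i) ]·_) (sym (R.*-identityʳ x)))
                                      (sym (*-[]· x (does (k Fin.≟ i)) 1#)))
      (∑-distribˡ-* x _ L)
    N≤c : N ≤ c
    N≤c = *-cancelˡ-≤ (0≤h , 0≢h) (begin
      h * N               ≡⟨ scaled h ⟨
      ∑ L (λ (_ , k) → [ does (k Fin.≟ i) ]· h)
        ≤⟨ ∑-mono L (λ {(a , k)} x∈ → []·-mono (does (k Fin.≟ i)) (proj₁ (h<w (∈-map⁺ proj₁ x∈)))) ⟩
      machineLoad w L i   ≤⟨ w-load i ⟩
      c * h               ≡⟨ R.*-comm c h ⟩
      h * c               ∎)
  machineLoad-count []            _ 0≤c 0≤C _ _ _ _ i | yes _ = *-nonNegative 0≤c 0≤C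
  machineLoad-count {w = w} {c = c} ((a , k) ∷ L) _ _ _ 0≤w h<w _ w-load i | yes refl =
    ⊥-elim (<⇒≱ (h<w (here refl)) (subst (w a ≤_) (R.zeroʳ c) (O.trans wa≤ (w-load k))))
    where
    wa≤ : w a ≤ machineLoad w ((a , k) ∷ L) k
    wa≤ with k Fin.≟ k
    ... | yes _  = x≤x+y (∑-nonNegative L λ (a , i) → []·-nonNegative (does (i Fin.≟ k)) (0≤w a))
    ... | no k≢k = ⊥-elim (k≢k refl)

  -- The lower bounds by `h` limit how many pieces a machine of bounded `q`-load can hold; the upper
  -- bounds limit what greedy placement and a single rest add to a load.
  record Cut (q : A → Carrier) (h : Carrier) (xs : List A) : Set where
    field
      big        : List A
      bundles    : List (List A)
      rest       : List A
      cut-↭      : (big ++ concat bundles) ++ rest ↭ xs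
      big>h      : ∀ {x} → x ∈ big → h < q x
      bundle>h   : ∀ {b} → b ∈ bundles → h < ∑ b q
      bundle≤h+h : ∀ {b} → b ∈ bundles → ∑ b q ≤ h + h
      rest≤h     : ∑ rest q ≤ h

  -- A job of size at most `h` joins the open rest. If this pushes the rest above `h`, the rest is
  -- closed as a bundle, of size at most `h + h` because the job and the old rest have size at most
  -- `h` each.
  cut : (q : A → Carrier) {h : Carrier} → 0# ≤ h → ∀ xs → Cut q h xs
  cut q 0≤h [] = record
    { big = [] ; bundles = [] ; rest = [] ; cut-↭ = ↭-refl
    ; big>h = λ () ; bundle>h = λ () ; bundle≤h+h = λ () ; rest≤h = 0≤h }
  cut {A} q {h} 0≤h (x ∷ xs) = extend (cut q 0≤h xs) (q x O.≤? h)
    where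
    extend : Cut q h xs → Dec (q x ≤ h) → Cut q h (x ∷ xs)
    extend c (no qx≰h) = record
      { Cut c
      ; big = x ∷ Cut.big c
      ; cut-↭ = ↭.prep x (Cut.cut-↭ c)
      ; big>h = λ { (here refl) → ≰⇒< qx≰h ; (there x∈) → Cut.big>h c x∈ } }
    extend c (yes qx≤h) with (q x + ∑ (Cut.rest c) q) O.≤? h
    ... | yes x∷rest≤h = record
      { Cut c
      ; rest = x ∷ Cut.rest c
      ; cut-↭ = ↭-trans (↭.shift x (Cut.big c ++ concat (Cut.bundles c)) (Cut.rest c))
                        (↭.prep x (Cut.cut-↭ c))
      ; rest≤h = x∷rest≤h }
    ... | no x∷rest≰h = record
      { Cut c
      ; bundles = (x ∷ Cut.rest c) ∷ Cut.bundles c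
      ; rest = []
      ; cut-↭ = ↭-trans (close-↭ x (Cut.big c) (Cut.rest c) (concat (Cut.bundles c)))
                        (↭.prep x (Cut.cut-↭ c))
      ; bundle>h   = λ { (here refl) → ≰⇒< x∷rest≰h ; (there b∈) → Cut.bundle>h c b∈ }
      ; bundle≤h+h = λ { (here refl) → +-mono-≤ qx≤h (Cut.rest≤h c)
                       ; (there b∈)  → Cut.bundle≤h+h c b∈ }
      ; rest≤h     = 0≤h }

  module _ {m n : ℕ} (p̂ : Sizes n) (0≤p̂ : NonNegative p̂) {h : Carrier} (0≤h : 0# ≤ h)
           (g : Fin m → List (Fin n)) (g-↭ : concatMap g (allFin m) ↭ allFin n) where

    open Cut

    private
      cuts : ∀ k → Cut (lookup p̂) h (g k)
      cuts k = cut (lookup p̂) 0≤h (g k)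

      bigs : List (Fin n)
      bigs = concatMap (big ∘ cuts) (allFin m)

      closed : List (List (Fin n))
      closed = concatMap (bundles ∘ cuts) (allFin m)

      -- The rest of part `k` goes to machine `k`, so that every machine gets exactly one.
      rests : List (List (Fin n) × Fin m)
      rests = map (λ k → rest (cuts k) , k) (allFin m)

      -- Big jobs keep the machine given by `σ`, which is later read off an optimal schedule for
      -- `p̂`.
      initial : (Fin n → Fin m) → List (List (Fin n) × Fin m)
      initial σ = map (λ j → [ j ] , σ j) bigs

      size : List (Fin n) → Carrier
      size b = ∑ b (lookup p̂)

      proj₁-initial : ∀ σ → concat (map proj₁ (initial σ)) ≡ bigs
      proj₁-initial σ = trans (cong concat (sym (List.map-∘ bigs))) (List.concat-map-[ bigs ])

      proj₁-rests : concat (map proj₁ rests) ≡ concatMap (rest ∘ cuts) (allFin m)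
      proj₁-rests = cong concat (sym (List.map-∘ (allFin m)))

      pieces-↭ : (bigs ++ concat closed) ++ concatMap (rest ∘ cuts) (allFin m) ↭ allFin n
      pieces-↭ = ↭-trans (concatMap-pieces-↭ (cut-↭ ∘ cuts) (allFin m)) g-↭

      -- The cut is made by `p̂`, but its pieces are sublists of `g k` up to order, so they cost no
      -- more than `g k` under any nonnegative sizes `p`. This carries robust bounds from parts to
      -- pieces.
      cut-⊆ : ∀ {p : Fin n → Carrier} → (∀ j → 0# ≤ p j) → ∀ k →
              ∑ (big (cuts k)) p ≤ ∑ (g k) p × ∑ (concat (bundles (cuts k))) p ≤ ∑ (g k) p ×
              ∑ (rest (cuts k)) p ≤ ∑ (g k) p
      cut-⊆ 0≤p k = ∑-⊆ (big (cuts k)) (concat (bundles (cuts k))) (rest (cuts k)) 0≤p (cut-↭ (cuts k))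

      ∈-machines : ∀ {A : Set} (f : Fin m → List A) {x} → x ∈ concatMap f (allFin m) → ∃[ k ] x ∈ f k
      ∈-machines f x∈ = Any.satisfied (∈-concatMap⁻ f {allFin m} x∈)

      rest≤ : ∀ {p : Fin n → Carrier} → (∀ j → 0# ≤ p j) → ∀ k → ∑ (rest (cuts k)) p ≤ ∑ (g k) p
      rest≤ 0≤p k = proj₂ (proj₂ (cut-⊆ 0≤p k))

      closed>h : ∀ {b} → b ∈ closed → h < size b
      closed>h b∈ with k , b∈k ← ∈-machines (bundles ∘ cuts) b∈ =
        bundle>h (cuts k) b∈k

      closed≤h+h : ∀ {b} → b ∈ closed → size b ≤ h + h
      closed≤h+h b∈ with k , b∈k ← ∈-machines (bundles ∘ cuts) b∈ =
        bundle≤h+h (cuts k) b∈k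

      closed≤ : ∀ {p : Fin n → Carrier} {C} → (∀ j → 0# ≤ p j) → (∀ k → ∑ (g k) p ≤ C) →
                ∀ {b} → b ∈ closed → ∑ b p ≤ C
      closed≤ 0≤p g≤C b∈ with k , b∈k ← ∈-machines (bundles ∘ cuts) b∈ =
        O.trans (∑-∈-concat 0≤p b∈k)
          (O.trans (proj₁ (proj₂ (cut-⊆ 0≤p k))) (g≤C k))

      bigs>h : ∀ {j} → j ∈ bigs → h < lookup p̂ j
      bigs>h j∈ with k , j∈k ← ∈-machines (big ∘ cuts) j∈ = big>h (cuts k) j∈k

      bigs≤ : ∀ {p : Fin n → Carrier} {C} → (∀ j → 0# ≤ p j) → (∀ k → ∑ (g k) p ≤ C) →
              ∀ {j} → j ∈ bigs → p j ≤ C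
      bigs≤ 0≤p g≤C j∈ with k , j∈k ← ∈-machines (big ∘ cuts) j∈ =
        O.trans (≤-∑ 0≤p j∈k) (O.trans (proj₁ (cut-⊆ 0≤p k)) (g≤C k))

      -- All pieces of `p̂`-size above `h`, the ones whose number per machine is limited by
      -- `machineLoad-count`.
      full : (Fin n → Fin m) → List (List (Fin n))
      full σ = closed ++ map proj₁ (initial σ)

      full-∈ : ∀ {σ} (Q : List (Fin n) → Set) → (∀ {b} → b ∈ closed → Q b) →
               (∀ {j} → j ∈ bigs → Q [ j ]) → ∀ {b} → b ∈ full σ → Q b
      full-∈ {σ} Q Q-closed Q-bigs b∈ with ∈-++⁻ closed b∈
      ... | inj₁ b∈closed = Q-closed b∈closed
      ... | inj₂ b∈big with _ , x∈ , refl ← ∈-map⁻ proj₁ b∈big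
                       with j , j∈ , refl ← ∈-map⁻ (λ j → [ j ] , σ j) x∈ = Q-bigs j∈

      full>h : ∀ {σ b} → b ∈ full σ → h < size b
      full>h {σ} = full-∈ {σ} (λ b → h < size b) closed>h
        λ {j} j∈ → subst (h <_) (sym (R.+-identityʳ (lookup p̂ j))) (bigs>h j∈)

      full≤ : ∀ {p : Fin n → Carrier} {C} → (∀ j → 0# ≤ p j) → (∀ k → ∑ (g k) p ≤ C) →
              ∀ {σ b} → b ∈ full σ → ∑ b p ≤ C
      full≤ {p} {C} 0≤p g≤C {σ} = full-∈ {σ} (λ b → ∑ b p ≤ C) (closed≤ 0≤p g≤C)
        λ {j} j∈ → subst (_≤ C) (sym (R.+-identityʳ (p j))) (bigs≤ 0≤p g≤C j∈)

      concat-full : ∀ σ → concat (full σ) ≡ concat closed ++ bigs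
      concat-full σ = trans (sym (List.concat-++ closed _)) (cong (concat closed ++_) (proj₁-initial σ))

      full-↭ : ∀ σ {L} → map proj₁ L ≡ full σ → map proj₁ (concatMap spread (L ++ rests)) ↭ allFin n
      full-↭ σ {L} eq = ↭-trans (↭.↭-reflexive eq′)
        (↭-trans (↭.++⁺ʳ _ (↭.++-comm (concat closed) bigs)) pieces-↭)
        where
        eq′ : map proj₁ (concatMap spread (L ++ rests)) ≡
              (concat closed ++ bigs) ++ concatMap (rest ∘ cuts) (allFin m)
        eq′ = trans (map-proj₁-spreads (L ++ rests))
          (trans (cong concat (List.map-++ proj₁ L rests))
            (trans (sym (List.concat-++ (map proj₁ L) (map proj₁ rests)))
              (cong₂ _++_
                (trans (cong concat eq) (concat-full σ))
                proj₁-rests)))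

      size-nonNegative : ∀ b → 0# ≤ size b
      size-nonNegative b = ∑-nonNegative b 0≤p̂

    module _ {P : Carrier} (σ : Fin n → Fin m)
             (σ≤P : ∀ i → ∑ (allFin n) (λ j → [ does (σ j Fin.≟ i) ]· lookup p̂ j) ≤ P)
             (total≤ : ∑ (allFin n) (lookup p̂) ≤ ∑ (allFin m) λ _ → P) (i₀ : Fin m) where

      private
        initial≤P : ∀ i → machineLoad size (initial σ) i ≤ P
        initial≤P i = begin
          machineLoad size (initial σ) i
            ≡⟨ ∑-map _ (λ j → [ j ] , σ j) bigs ⟩
          ∑ bigs (λ j → [ does (σ j Fin.≟ i) ]· (lookup p̂ j + 0#))
            ≡⟨ ∑-cong bigs (λ {j} _ → cong ([ does (σ j Fin.≟ i) ]·_) (R.+-identityʳ (lookup p̂ j))) ⟩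
          ∑ bigs (λ j → [ does (σ j Fin.≟ i) ]· lookup p̂ j)
            ≤⟨ proj₁ (∑-⊆ bigs (concat closed) _
                 (λ j → []·-nonNegative (does (σ j Fin.≟ i)) (0≤p̂ j)) pieces-↭) ⟩
          ∑ (allFin n) (λ j → [ does (σ j Fin.≟ i) ]· lookup p̂ j)
            ≤⟨ σ≤P i ⟩
          P ∎

        full-total : ∑ (full σ) size ≤ ∑ (allFin m) λ _ → P
        full-total = begin
          ∑ (full σ) size                                 ≡⟨ ∑-concat (lookup p̂) (full σ) ⟨
          ∑ (concat (full σ)) (lookup p̂)                  ≡⟨ cong (λ l → ∑ l (lookup p̂)) (concat-full σ) ⟩
          ∑ (concat closed ++ bigs) (lookup p̂)            ≤⟨ x≤x+y (∑-nonNegative small 0≤p̂) ⟩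
          ∑ (concat closed ++ bigs) (lookup p̂) + ∑ small (lookup p̂)
            ≡⟨ ∑-++ (lookup p̂) (concat closed ++ bigs) small ⟨
          ∑ ((concat closed ++ bigs) ++ small) (lookup p̂)
            ≡⟨ ∑-↭ (lookup p̂) (↭-trans (↭.++⁺ʳ small (↭.++-comm (concat closed) bigs)) pieces-↭) ⟩
          ∑ (allFin n) (lookup p̂)                         ≤⟨ total≤ ⟩
          ∑ (allFin m) (λ _ → P)                          ∎
          where
          small : List (Fin n)
          small = concatMap (rest ∘ cuts) (allFin m)

        placed : ∃[ L ] map proj₁ L ≡ full σ × (∀ i → machineLoad size L i ≤ P + (h + h))
        placed = listSchedule i₀ size (+-nonNegative 0≤h 0≤h) (initial σ) initial≤P closed
          (λ {b} b∈ → size-nonNegative b , closed≤h+h b∈) full-total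

        L : List (List (Fin n) × Fin m)
        L = proj₁ placed

        L≡full : map proj₁ L ≡ full σ
        L≡full = proj₁ (proj₂ placed)

        L≤ : ∀ i → machineLoad size L i ≤ P + (h + h)
        L≤ = proj₂ (proj₂ placed)

        scheduled : ∃[ S ] ∀ p i → load S p i ≡ machineLoad (lookup p) (concatMap spread (L ++ rests)) i
        scheduled = schedule (concatMap spread (L ++ rests)) (full-↭ σ L≡full)

      refined : Schedule m n
      refined = proj₁ scheduled

      private
        load-refined : ∀ p i → load refined p i ≡
                       machineLoad (λ b → ∑ b (lookup p)) L i + ∑ (rest (cuts i)) (lookup p)
        load-refined p i = begin-equality
          load refined p i
            ≡⟨ proj₂ scheduled p i ⟩
          machineLoad (lookup p) (concatMap spread (L ++ rests)) i
            ≡⟨ machineLoad-spread (lookup p) (L ++ rests) i ⟩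
          machineLoad ∑p (L ++ rests) i
            ≡⟨ ∑-++ _ L rests ⟩
          machineLoad ∑p L i + machineLoad ∑p rests i
            ≡⟨ cong (machineLoad ∑p L i +_) (∑-map _ _ (allFin m)) ⟩
          machineLoad ∑p L i + ∑ (allFin m) (λ k → [ does (k Fin.≟ i) ]· ∑p (rest (cuts k)))
            ≡⟨ cong (machineLoad ∑p L i +_) (∑-indicatorˡ (∑p ∘ rest ∘ cuts) i) ⟩
          machineLoad ∑p L i + ∑p (rest (cuts i)) ∎
          where
          ∑p : List (Fin n) → Carrier
          ∑p b = ∑ b (lookup p)

      -- Greedy placement overshoots `P` by at most one bundle, of size at most `h + h`; the last
      -- `h` pays for the rest.
      refined-p̂ : ∀ i → load refined p̂ i ≤ P + (h + h) + h
      refined-p̂ i = subst (_≤ P + (h + h) + h) (sym (load-refined p̂ i))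
        (+-mono-≤ (L≤ i) (rest≤h (cuts i)))

      refined-≤ : ∀ {μ} → 0# ≤ μ → μ * h ≡ P → ∀ {p C} → NonNegative p →
                  (∀ k → ∑ (g k) (lookup p) ≤ C) → ∀ i → load refined p i ≤ (μ + fromℕ 4) * C
      refined-≤ {μ} 0≤μ μh≡P {p} {C} 0≤p g≤C i = begin
        load refined p i
          ≡⟨ load-refined p i ⟩
        machineLoad (λ b → ∑ b (lookup p)) L i + ∑ (rest (cuts i)) (lookup p)
          ≤⟨ +-mono-≤ bundles≤ (O.trans (rest≤ 0≤p i) (g≤C i)) ⟩
        (μ + fromℕ 2) * C + C
          -- Large pieces and the rest cost at most μ + 3 copies of `C`; this is rounded up to μ +
          -- 4, the factor that gives 10λ + 20 for μ = 2λ and `C` equal to five times the robust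
          -- optimum.
          ≤⟨ x≤x+y 0≤C ⟩
        (μ + fromℕ 2) * C + C + C
          ≡⟨ solve 2 (λ a b → (a :+ nat 2) :* b :+ b :+ b := (a :+ nat 4) :* b) refl μ C ⟩
        (μ + fromℕ 4) * C ∎
        where
        0≤C : 0# ≤ C
        0≤C = O.trans (∑-nonNegative (g i) 0≤p) (g≤C i)
        -- The `p̂`-load bound P + 2h equals (μ + 2)h, so a machine holds at most μ + 2 pieces above
        -- `h`, each of cost at most `C`.
        bundles≤ : machineLoad (λ b → ∑ b (lookup p)) L i ≤ (μ + fromℕ 2) * C
        bundles≤ = machineLoad-count L 0≤h (+-nonNegative 0≤μ (fromℕ-nonNegative 2)) 0≤C size-nonNegative
          (full>h {σ} ∘ subst (_ ∈_) L≡full)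
          (full≤ 0≤p g≤C {σ} ∘ subst (_ ∈_) L≡full)
          (λ k → subst (machineLoad size L k ≤_) (trans (cong (_+ (h + h)) (sym μh≡P))
             (solve 2 (λ a b → a :* b :+ (b :+ b) := (a :+ nat 2) :* b) refl μ h)) (L≤ k)) i

-- A partition balanced for all budgets at once.

module Balancing (ℝ : Reals) where

  open OrderedField ℝ

  decTotalOrder : DecTotalOrder 0ℓ 0ℓ 0ℓ
  decTotalOrder = record { isDecTotalOrder = isDecTotalOrder }

  module _ {J : Set} (a d : J → Carrier) (0≤a : ∀ j → 0# ≤ a j) where

    -- Bounds are needed for every such e at once, as the excess (d − θ)⁺ depends on the
    -- budget but the partition must not.
    record Scale (e : J → Carrier) (M : Carrier) : Set where
      field
        0≤M         : 0# ≤ M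
        nonNegative : ∀ j → 0# ≤ e j
        monotone    : ∀ {i j} → d i ≤ d j → e i ≤ e j
        bounded     : ∀ j → e j ≤ M

    Gap : (J → Carrier) → Carrier → List (List J) → Set
    Gap f M bins = ∀ {x y} → x ∈ bins → y ∈ bins → ∑ x f ≤ ∑ y f + M

    Gap-resp-↭ : ∀ {f M bins bins′} → bins ↭ bins′ → Gap f M bins → Gap f M bins′
    Gap-resp-↭ p gap x∈ y∈ = gap (↭.∈-resp-↭ (↭-sym p) x∈) (↭.∈-resp-↭ (↭-sym p) y∈)

    Descending : (J → Carrier) → List J → Set
    Descending f = AllPairs λ i j → f j ≤ f i

    -- The head bin `b` is the lightest and receives the heaviest job `q`. It then exceeds a later
    -- bin by at most `a q ≤ M`, as that bin was no lighter before; a later bin gains at most `a q`,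
    -- so its lead over the head does not grow beyond the old `M`.
    deal-gap : ∀ {M} → 0# ≤ M → (∀ j → a j ≤ M) → ∀ qs bs → Descending a qs →
               AllPairs (λ x y → ∑ x a ≤ ∑ y a) bs → Gap a M bs → Gap a M (deal qs bs)
    deal-gap 0≤M a≤M []       bs       _ _ gap = gap
    deal-gap {M} 0≤M a≤M (q ∷ qs) (b ∷ bs) (q≥ ∷ qs↘) (b≤ ∷ bs↗) gap = gap′
      where
      b≤tail : ∀ {y} → y ∈ deal qs bs → ∑ b a ≤ ∑ y a
      b≤tail y∈ with deal-∈ qs bs y∈
      ... | unchanged _ y∈bs        = All.lookup b≤ y∈bs
      ... | extended {q′} _ b′∈ refl = O.trans (All.lookup b≤ b′∈) (x≤y+x (0≤a q′))
      tail≤ : ∀ {x} → x ∈ deal qs bs → ∑ x a ≤ a q + (∑ b a + M)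
      tail≤ x∈ with deal-∈ qs bs x∈
      ... | unchanged _ x∈bs        = O.trans (gap (there x∈bs) (here refl)) (x≤y+x (0≤a q))
      ... | extended q∈ b′∈ refl    = +-mono-≤ (All.lookup q≥ q∈) (gap (there b′∈) (here refl))
      gap′ : Gap a M ((q ∷ b) ∷ deal qs bs)
      gap′         (here refl) (here refl) = x≤x+y 0≤M
      gap′ {y = y} (here refl) (there y∈)  = begin
        a q + ∑ b a     ≤⟨ +-mono-≤ (a≤M q) (b≤tail y∈) ⟩
        M + ∑ y a       ≡⟨ R.+-comm M _ ⟩
        ∑ y a + M       ∎
      gap′ {x = x} (there x∈)  (here refl) = begin
        ∑ x a                ≤⟨ tail≤ x∈ ⟩
        a q + (∑ b a + M)    ≡⟨ R.+-assoc (a q) _ M ⟨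
        a q + ∑ b a + M      ∎
      gap′         (there x∈)  (there y∈)  =
        deal-gap 0≤M a≤M qs bs qs↘ bs↗ (λ x∈ y∈ → gap (there x∈) (there y∈)) x∈ y∈

    -- For `js` in descending order of `d`, this is the largest `e` still to be dealt. The value 0
    -- on the empty list makes the term vanish once all jobs are dealt.
    first : (J → Carrier) → List J → Carrier
    first e []      = 0#
    first e (j ∷ _) = e j

    -- Loop invariant: `js` are the jobs still to be dealt and `bins` holds those dealt so far.
    record Balanced (js : List J) (bins : List (List J)) : Set where
      field
        a-gap : ∀ {M} → 0# ≤ M → (∀ j → a j ≤ M) → Gap a M bins
        -- The differences contributed by successive blocks telescope along the descending
        -- scale.
        e-gap : ∀ {e M} → Scale e M → ∀ {x y} → x ∈ bins → y ∈ bins →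
                ∑ x e + first e js ≤ ∑ y e + M

    open Balanced

    -- One round. A bin gains at most the first `e` of the block and at least the first `e` of what
    -- follows, so the difference of these two is all that the `e`-gap can grow by. A block shorter
    -- than the number of bins may only come last.
    dealBlock : ∀ block rest bins → Descending d (block ++ rest) →
                length block ≡ length bins ⊎ (length block ℕ.≤ length bins × rest ≡ []) →
                Balanced (block ++ rest) bins →
                ∃[ bins′ ] length bins′ ≡ length bins × concat bins′ ↭ block ++ concat bins ×
                  Balanced rest bins′
    dealBlock block rest bins ↘d len bal
      with qs , qs↭ , qs↘ ← sortOn (Flip.decTotalOrder decTotalOrder) a block
         | bs , bs↭ , bs↗ ← sortOn decTotalOrder (λ b → ∑ b a) bins
      = deal qs bs , trans (length-deal qs bs) (↭.↭-length bs↭)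
      , ↭-trans (deal-↭ qs bs qs≤bs) (↭.++⁺ qs↭ (↭-concat bs↭))
      , record
        { a-gap = λ 0≤M a≤M → deal-gap 0≤M a≤M qs bs qs↘ bs↗
                    (Gap-resp-↭ {a} (↭-sym bs↭) (a-gap bal 0≤M a≤M))
        ; e-gap = gap }
      where
      lengths : length qs ≡ length bs ⊎ (length qs ℕ.≤ length bs × rest ≡ [])
      lengths = subst₂ (λ k l → k ≡ l ⊎ (k ℕ.≤ l × rest ≡ []))
        (sym (↭.↭-length qs↭)) (sym (↭.↭-length bs↭)) len

      qs≤bs : length qs ℕ.≤ length bs
      qs≤bs = [ ℕ.≤-reflexive , proj₁ ]′ lengths

      module _ {e M} (s : Scale e M) where
        open Scale s

        first-nonNegative : ∀ js → 0# ≤ first e js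
        first-nonNegative []      = O.refl
        first-nonNegative (j ∷ _) = nonNegative j

        ≤first : ∀ js {q} → Descending d js → q ∈ js → e q ≤ first e js
        ≤first (j ∷ js) _         (here refl) = O.refl
        ≤first (j ∷ js) (j≥ ∷ _) (there q∈)  = monotone (All.lookup j≥ q∈)

        first-rest≤ : ∀ {q} → q ∈ block → first e rest ≤ e q
        first-rest≤ q∈ = go rest (proj₂ (AllPairs-++⁻ block ↘d))
          where
          go : ∀ js → (∀ {x y} → x ∈ block → y ∈ js → d y ≤ d x) → first e js ≤ e _
          go []       _  = nonNegative _
          go (j ∷ _)  le = monotone (le q∈ (here refl))

        block∈ : ∀ {q} → q ∈ qs → q ∈ block
        block∈ = ↭.∈-resp-↭ qs↭

        above : ∀ {x} → x ∈ deal qs bs → ∃[ b ] b ∈ bins × ∑ x e ≤ first e (block ++ rest) + ∑ b e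
        above x∈ with deal-∈ qs bs x∈
        ... | unchanged _ x∈bs = _ , ↭.∈-resp-↭ bs↭ x∈bs , x≤y+x (first-nonNegative (block ++ rest))
        ... | extended q∈ b∈ refl = _ , ↭.∈-resp-↭ bs↭ b∈ ,
          +-monoˡ-≤ _ (≤first (block ++ rest) ↘d (∈-++⁺ˡ (block∈ q∈)))

        below : ∀ {y} → y ∈ deal qs bs → ∃[ b ] b ∈ bins × first e rest + ∑ b e ≤ ∑ y e
        below y∈ with deal-∈ qs bs y∈
        ... | extended q∈ b∈ refl = _ , ↭.∈-resp-↭ bs↭ b∈ , +-monoˡ-≤ _ (first-rest≤ (block∈ q∈))
        -- A full block leaves no bin without a job. After a short block nothing follows, so a bin
        -- that gained nothing still gained `first e [] = 0`.
        ... | unchanged lt y∈bs with lengths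
        ...   | inj₁ eq         = ⊥-elim (ℕ.<⇒≢ lt eq)
        ...   | inj₂ (_ , refl) = _ , ↭.∈-resp-↭ bs↭ y∈bs , O.reflexive (R.+-identityˡ _)

        gap : ∀ {x y} → x ∈ deal qs bs → y ∈ deal qs bs → ∑ x e + first e rest ≤ ∑ y e + M
        gap {x} {y} x∈ y∈ with b , b∈ , x≤ ← above x∈ | b′ , b′∈ , ≤y ← below y∈ = begin
          ∑ x e + r               ≤⟨ +-monoˡ-≤ r x≤ ⟩
          f + ∑ b e + r           ≡⟨ cong (_+ r) (R.+-comm f _) ⟩
          ∑ b e + f + r           ≤⟨ +-monoˡ-≤ r (e-gap bal s b∈ b′∈) ⟩
          ∑ b′ e + M + r          ≡⟨ solve 3 (λ a b c → a :+ b :+ c := c :+ a :+ b) refl _ M r ⟩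
          r + ∑ b′ e + M          ≤⟨ +-monoˡ-≤ M ≤y ⟩
          ∑ y e + M               ∎
          where
          f r : Carrier
          f = first e (block ++ rest)
          r = first e rest

    -- Recursion is on `fuel` because `drop m js` is not a structural part of `js`.
    dealAll : ∀ fuel js bins → length js ℕ.≤ fuel → 0 ℕ.< length bins → Descending d js →
              Balanced js bins →
              ∃[ bins′ ] length bins′ ≡ length bins × concat bins′ ↭ js ++ concat bins ×
                Balanced [] bins′
    dealAll zero       []  bins _   _   _  bal = bins , refl , ↭-refl , bal
    dealAll (suc fuel) js bins len 0<m ↘d bal with length js ℕ.≤? length bins
    ... | yes js≤m = dealBlock js [] bins (subst (Descending d) js≡ ↘d)
                       (inj₂ (js≤m , refl)) (subst (λ js → Balanced js bins) js≡ bal)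
      where
      js≡ : js ≡ js ++ []
      js≡ = sym (List.++-identityʳ js)
    ... | no js≰m =
        let bins′ , l , p , bal′ = dealBlock block rest bins ↘d′ (inj₁ length-block)
                                     (subst (λ js → Balanced js bins) js≡ bal)
            bins″ , l′ , p′ , bal″ = dealAll fuel rest bins′ rest≤ (subst (0 ℕ.<_) (sym l) 0<m)
                                       (proj₁ (AllPairs-++⁻ block ↘d′)) bal′
        in bins″ , trans l′ l , perm p p′ , bal″
        where
        m : ℕ
        m = length bins
        block rest : List J
        block = take m js
        rest  = drop m js
        js≡ : js ≡ block ++ rest
        js≡ = sym (List.take++drop≡id m js)
        ↘d′ : Descending d (block ++ rest)
        ↘d′ = subst (Descending d) js≡ ↘d
        length-block : length block ≡ m
        length-block = trans (List.length-take m js) (ℕ.m≤n⇒m⊓n≡m (ℕ.<⇒≤ (ℕ.≰⇒> js≰m)))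
        -- As there is at least one bin, a full block removes at least one job.
        rest≤ : length rest ℕ.≤ fuel
        rest≤ = subst (ℕ._≤ fuel) (sym (List.length-drop m js))
          (ℕ.≤-trans (ℕ.∸-monoʳ-≤ (length js) 0<m) (ℕ.∸-monoˡ-≤ 1 len))
        perm : ∀ {xs ys zs : List J} → ys ↭ block ++ xs → zs ↭ rest ++ ys → zs ↭ js ++ xs
        perm {xs} p p′ = ↭-trans p′ (↭-trans (↭.++⁺ˡ rest p) (↭-trans (↭.shifts rest block)
          (↭.↭-reflexive (trans (sym (List.++-assoc block rest xs)) (cong (_++ xs) (sym js≡))))))

    record BalancedPartition (m : ℕ) (js : List J) : Set where
      field
        part     : Fin m → List J
        part-↭   : concatMap part (allFin m) ↭ js
        part-gap : ∀ {M} → 0# ≤ M → (∀ j → a j ≤ M) →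
                   ∀ i k → ∑ (part i) a ≤ ∑ (part k) a + M
        scale-gap : ∀ {e M} → Scale e M → ∀ i k → ∑ (part i) e ≤ ∑ (part k) e + M

    balanced : ∀ m → 0 ℕ.< m → ∀ js → BalancedPartition m js
    balanced m 0<m js =
      let js′ , js′↭ , ↘d = sortOn (Flip.decTotalOrder decTotalOrder) d js
          bins , l , p , bal = dealAll (length js′) js′ (replicate m []) ℕ.≤-refl
                                 (subst (0 ℕ.<_) (sym (List.length-replicate m)) 0<m) ↘d replicate-balanced
      in fromBins bins (trans l (List.length-replicate m))
           (↭-trans p (↭-trans (↭.++⁺ js′↭ (↭.↭-reflexive (concat-replicate-[] m)))
                                (↭.↭-reflexive (List.++-identityʳ js)))) bal
      where
      concat-replicate-[] : ∀ m → concat (replicate m []) ≡ List.[] {A = J}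
      concat-replicate-[] zero    = refl
      concat-replicate-[] (suc m) = concat-replicate-[] m

      ∈-replicate : ∀ {m} {x y : List J} → x ∈ replicate m y → x ≡ y
      ∈-replicate {suc m} (here eq)  = eq
      ∈-replicate {suc m} (there x∈) = ∈-replicate {m} x∈

      -- For empty bins the sums are 0, and the starting term `first e js` of the telescoping sum is
      -- paid for by the bound `M` on `e`.
      replicate-balanced : ∀ {js} → Balanced js (replicate m [])
      replicate-balanced .a-gap 0≤M _ x∈ y∈
        with refl ← ∈-replicate {m} x∈ | refl ← ∈-replicate {m} y∈ = x≤x+y 0≤M
      replicate-balanced {js} .e-gap {e} {M} s x∈ y∈
        with refl ← ∈-replicate {m} x∈ | refl ← ∈-replicate {m} y∈ =
        +-monoʳ-≤ 0# (first≤ js)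
        where
        first≤ : ∀ js → first e js ≤ M
        first≤ []      = Scale.0≤M s
        first≤ (j ∷ _) = Scale.bounded s j

      fromBins : ∀ bins → length bins ≡ m → concat bins ↭ js → Balanced [] bins → BalancedPartition m js
      fromBins bins refl p bal = record
        { part      = List.lookup bins
        ; part-↭    = subst (_↭ js) (cong concat (sym lookups)) p
        ; part-gap  = λ 0≤M a≤M i k → a-gap bal 0≤M a≤M (∈-lookup i) (∈-lookup k)
        ; scale-gap = λ {e} {M} s i k → subst (_≤ ∑ (List.lookup bins k) e + M) (R.+-identityʳ _)
            (e-gap bal s (∈-lookup i) (∈-lookup k)) }
        where
        lookups : map (List.lookup bins) (allFin (length bins)) ≡ bins
        lookups = trans (List.map-tabulate id (List.lookup bins)) (List.tabulate-lookup bins)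

-- The balanced partition against the robust optimum.

module Robustness (ℝ : Reals) where

  open OrderedField ℝ
  open Scheduling ℝ
  open Refinement ℝ
  open Balancing ℝ

  i₀ : ∀ {m} .{{_ : NonZero m}} → Fin m
  i₀ {m} = fromℕ< (ℕ.>-nonZero⁻¹ m)

  fromℕ-mono : ∀ {k l} → k ℕ.≤ l → fromℕ k ≤ fromℕ l
  fromℕ-mono {l = l} ℕ.z≤n = fromℕ-nonNegative l
  fromℕ-mono (ℕ.s≤s k≤l)   = +-monoʳ-≤ 1# (fromℕ-mono k≤l)

  fromℕ-positive : ∀ {k} → 0 ℕ.< k → 0# < fromℕ k
  fromℕ-positive {suc k} _ = 0<1+x (fromℕ-nonNegative k)

  ∑-subset : ∀ {n} (T : Subset n) x → ∑ (allFin n) (λ j → [ lookup T j ]· x) ≡ fromℕ ∣ T ∣ * x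
  ∑-subset T x = trans (∑-allFin λ j → [ lookup T j ]· x) (go T)
    where
    go : ∀ {n} (T : Subset n) → sum (λ j → [ lookup T j ]· x) ≡ fromℕ ∣ T ∣ * x
    go []          = sym (R.zeroˡ x)
    go (true ∷ T)  = trans (cong (x +_) (go T))
      (solve 2 (λ a b → b :+ a :* b := (con 1 :+ a) :* b) refl (fromℕ ∣ T ∣) x)
    go (false ∷ T) = trans (R.+-identityˡ _) (go T)

  module Excess (θ : Carrier) (0≤θ : 0# ≤ θ) where

    -- The positive part (x - θ)⁺.
    excess : Carrier → Carrier
    excess x = if does (x O.≤? θ) then 0# else x + - θ

    θ+[x-θ]≡x : ∀ x → θ + (x + - θ) ≡ x
    θ+[x-θ]≡x = x+[y-x]≡y θ

    x-θ≤x : ∀ x → x + - θ ≤ x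
    x-θ≤x x = +-cancelˡ-≤ θ (subst (_≤ θ + x) (sym (θ+[x-θ]≡x x)) (x≤y+x 0≤θ))

    excess-nonNegative : ∀ x → 0# ≤ excess x
    excess-nonNegative x with x O.≤? θ
    ... | yes _  = O.refl
    ... | no x≰θ = x≤y⇒0≤y-x (proj₁ (≰⇒< x≰θ))

    ≤θ+excess : ∀ x → x ≤ θ + excess x
    ≤θ+excess x with x O.≤? θ
    ... | yes x≤θ = O.trans x≤θ (x≤x+y O.refl)
    ... | no _    = O.reflexive (sym (θ+[x-θ]≡x x))

    excess-mono : ∀ {x y} → x ≤ y → excess x ≤ excess y
    excess-mono {x} {y} x≤y with x O.≤? θ | y O.≤? θ
    ... | yes _  | yes _   = O.refl
    ... | yes _  | no y≰θ  = x≤y⇒0≤y-x (proj₁ (≰⇒< y≰θ))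
    ... | no x≰θ | yes y≤θ = ⊥-elim (x≰θ (O.trans x≤y y≤θ))
    ... | no _   | no _    = +-monoˡ-≤ (- θ) x≤y

    excess≤ : ∀ {x y} → 0# ≤ y → x ≤ y → excess x ≤ y
    excess≤ {x} 0≤y x≤y with x O.≤? θ
    ... | yes _ = 0≤y
    ... | no _  = O.trans (x-θ≤x x) x≤y

  module _ {m n : ℕ} .{{_ : NonZero m}} where

    load≤Cmax : ∀ (S : Schedule m n) p i → load S p i ≤ Cmax S p
    load≤Cmax S p = proj₂ (proj₂ (makespan-maximum S p))

    Cmax-least : ∀ (S : Schedule m n) p {c} → (∀ i → load S p i ≤ c) → Cmax S p ≤ c
    Cmax-least S p load≤c with (i , eq) , _ ← proj₂ (makespan-maximum S p) = subst (_≤ _) eq (load≤c i)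

    -- Expresses that the worst case of `S` is at most `c`, with both maxima unfolded.
    RobustlyBounded : (p⁻ p⁺ : Sizes n) → ℕ → Schedule m n → Carrier → Set
    RobustlyBounded p⁻ p⁺ Γ S c = ∀ p → InBudgetSet p⁻ p⁺ Γ p → ∀ i → load S p i ≤ c

    module _ (p⁻ p⁺ : Sizes n) (p⁻≤p⁺ : p⁻ ≤ᵛ p⁺) (Γ : ℕ) where

      worstCase-least : ∀ (S : Schedule m n) {c} → RobustlyBounded p⁻ p⁺ Γ S c →
                        worstCase p⁻ p⁺ p⁻≤p⁺ Γ S ≤ c
      worstCase-least S {c} load≤c
        with ((p , u) , eq) , _ ← proj₂ (worstCase-maximum p⁻ p⁺ p⁻≤p⁺ Γ S) =
        subst (_≤ c) eq (Cmax-least S p (load≤c p u))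

      robustOptimum : Schedule m n
      robustOptimum = proj₁ (proj₁ (proj₂ (OPTʳᵒᵇ-minimum p⁻ p⁺ p⁻≤p⁺ Γ m)))

      robustOptimum-bounded : RobustlyBounded p⁻ p⁺ Γ robustOptimum (OPTʳᵒᵇ p⁻ p⁺ p⁻≤p⁺ Γ m)
      robustOptimum-bounded p u i = O.trans (load≤Cmax robustOptimum p i) (O.trans
        (proj₂ (proj₂ (worstCase-maximum p⁻ p⁺ p⁻≤p⁺ Γ robustOptimum)) (p , u))
        (O.reflexive (proj₂ (proj₁ (proj₂ (OPTʳᵒᵇ-minimum p⁻ p⁺ p⁻≤p⁺ Γ m))))))

    -- Consequences of a robust bound `R*` for a schedule `S*`.

    module LowerBounds (p⁻ p⁺ : Sizes n) (0≤p⁻ : NonNegative p⁻) (p⁻≤p⁺ : p⁻ ≤ᵛ p⁺)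
                       (Γ : ℕ) (1≤Γ : 1 ℕ.≤ Γ) (R* : Carrier) (S* : Schedule m n)
                       (load≤R : RobustlyBounded p⁻ p⁺ Γ S* R*) where

      open Schedule S*

      a d : Fin n → Carrier
      a = lookup p⁻
      d j = lookup p⁺ j + - lookup p⁻ j

      d≤p⁺ : ∀ j → d j ≤ lookup p⁺ j
      d≤p⁺ j = subst (d j ≤_) (x+[y-x]≡y (a j) (lookup p⁺ j)) (x≤y+x (0≤p⁻ j))

      raised : Subset n → Fin n → Carrier
      raised T j = if lookup T j then lookup p⁺ j else lookup p⁻ j

      raised-load : ∀ T → ∣ T ∣ ℕ.≤ Γ → ∀ i →
                    ∑ (allFin n) (λ j → [ lookup (part i) j ]· raised T j) ≤ R*
      raised-load T ∣T∣≤Γ i = subst (_≤ R*) eq (load≤R p (T , ∣T∣≤Γ , out , ins) i)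
        where
        p : Sizes n
        p = Vec.tabulate (raised T)
        eq : load S* p i ≡ ∑ (allFin n) (λ j → [ lookup (part i) j ]· raised T j)
        eq = trans (load-∑ S* p i) (∑-cong (allFin n) λ {j} _ →
          cong ([ lookup (part i) j ]·_) (lookup∘tabulate (raised T) j))
        out : ∀ j → j Subset.∉ T → lookup p j ≡ lookup p⁻ j
        out j j∉T = trans (lookup∘tabulate (raised T) j) lower
          where
          lower : raised T j ≡ lookup p⁻ j
          lower with lookup T j in eq
          ... | true  = ⊥-elim (j∉T (lookup⇒[]= j T eq))
          ... | false = refl
        ins : ∀ j → j Subset.∈ T → lookup p⁻ j ≤ lookup p j × lookup p j ≤ lookup p⁺ j
        ins j j∈T rewrite lookup∘tabulate (raised T) j | []=⇒lookup j∈T = p⁻≤p⁺ j , O.refl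

      p⁻-load : ∀ i → ∑ (allFin n) (λ j → [ lookup (part i) j ]· a j) ≤ R*
      p⁻-load i = O.trans
        (∑-mono (allFin n) λ {j} _ → []·-mono (lookup (part i) j) (≤raised j))
        (raised-load ⊥ (subst (ℕ._≤ Γ) (sym (Subset.∣⊥∣≡0 n)) ℕ.z≤n) i)
        where
        ≤raised : ∀ j → a j ≤ raised ⊥ j
        ≤raised j with lookup ⊥ j
        ... | true  = p⁻≤p⁺ j
        ... | false = O.refl

      raised-nonNegative : ∀ T j → 0# ≤ raised T j
      raised-nonNegative T j with lookup T j
      ... | true  = O.trans (0≤p⁻ j) (p⁻≤p⁺ j)
      ... | false = 0≤p⁻ j

      -- Since 1 ≤ Γ, job `j` alone may be raised, and some machine of `S*` then carries it at size
      -- `p⁺`.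
      p⁺≤R : ∀ j → lookup p⁺ j ≤ R*
      p⁺≤R j with i , j∈i ← covers j = begin
        lookup p⁺ j
          ≡⟨ cong (if_then lookup p⁺ j else lookup p⁻ j) ([]=⇒lookup (Subset.x∈⁅x⁆ j)) ⟨
        raised ⁅ j ⁆ j
          ≡⟨ cong ([_]· raised ⁅ j ⁆ j) ([]=⇒lookup j∈i) ⟨
        [ lookup (part i) j ]· raised ⁅ j ⁆ j
          ≤⟨ ≤-∑ {f = λ j′ → [ lookup (part i) j′ ]· raised ⁅ j ⁆ j′}
               (λ j′ → []·-nonNegative (lookup (part i) j′) (raised-nonNegative ⁅ j ⁆ j′)) (∈-allFin j) ⟩
        ∑ (allFin n) (λ j′ → [ lookup (part i) j′ ]· raised ⁅ j ⁆ j′)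
          ≤⟨ raised-load ⁅ j ⁆ (subst (ℕ._≤ Γ) (sym (Subset.∣⁅x⁆∣≡1 j)) 1≤Γ) i ⟩
        R* ∎

      0≤R : 0# ≤ R*
      0≤R = O.trans (∑-nonNegative (allFin n) λ j → []·-nonNegative (lookup (part i₀) j) (0≤p⁻ j))
                    (p⁻-load i₀)

      0<Γ : 0# < fromℕ Γ
      0<Γ = fromℕ-positive 1≤Γ

      -- If Γ jobs on a machine of S* had deviation above θ, raising them would cost more than
      -- Γ θ = R*.
      θ : Carrier
      θ = fromℕ Γ ⁻¹ * R*

      0≤θ : 0# ≤ θ
      0≤θ = *-nonNegative (⁻¹-nonNegative 0<Γ) 0≤R

      Γ*θ≡R : fromℕ Γ * θ ≡ R*
      Γ*θ≡R = x*[x⁻¹*y]≡y R* 0<Γ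

      open Excess θ 0≤θ

      e : Fin n → Carrier
      e = excess ∘ d

      -- `G` consists of the jobs on machine `i` with deviation above `θ`, the only ones there with
      -- nonzero excess. If `G` fits into the budget, raising it costs at least the excess, as e ≤ d
      -- ≤ p⁺.
      excess-load : ∀ i → ∑ (allFin n) (λ j → [ lookup (part i) j ]· e j) ≤ R*
      excess-load i = go (truncate Γ G)
        where
        G : Subset n
        G = Vec.tabulate λ j → lookup (part i) j ∧ not (does (d j O.≤? θ))

        G⇒ : ∀ {j} → j Subset.∈ G → lookup (part i) j ≡ true × ¬ d j ≤ θ
        G⇒ {j} j∈G with lookup (part i) j | d j O.≤? θ
                      | trans (sym (lookup∘tabulate (λ j → lookup (part i) j ∧ not (does (d j O.≤? θ))) j))
                              ([]=⇒lookup j∈G)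
        ... | true | no d≰θ | _ = refl , d≰θ
        ... | true | yes _  | ()
        ... | false | _     | ()

        e≤raised : ∀ j → [ lookup (part i) j ]· e j ≤ [ lookup (part i) j ]· raised G j
        e≤raised j rewrite lookup∘tabulate (λ j → lookup (part i) j ∧ not (does (d j O.≤? θ))) j
          with lookup (part i) j
        ... | false = O.refl
        ... | true with d j O.≤? θ
        ...   | yes _ = 0≤p⁻ j
        ...   | no _  = O.trans (x-θ≤x (d j)) (d≤p⁺ j)

        go : (∃[ T ] T Subset.⊆ G × ∣ T ∣ ℕ.≤ Γ × (T ≡ G ⊎ ∣ T ∣ ≡ Γ)) →
             ∑ (allFin n) (λ j → [ lookup (part i) j ]· e j) ≤ R*
        go (T , _ , ∣T∣≤Γ , inj₁ refl) =
          O.trans (∑-mono (allFin n) λ {j} _ → e≤raised j) (raised-load G ∣T∣≤Γ i)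
        -- Raising exactly Γ jobs of `G` costs at least Γ θ = `R*` plus their excess, so the excess
        -- is 0; but each job of `T` deviates by more than `θ`. Some job exists because Γ is
        -- positive.
        go (T , T⊆G , ∣T∣≤Γ , inj₂ ∣T∣≡Γ)
          with j₀ , j₀∈T ← 0<∣T∣⇒nonempty T (subst (0 ℕ.<_) (sym ∣T∣≡Γ) 1≤Γ) =
          ⊥-elim (proj₂ (G⇒ (T⊆G j₀∈T)) (begin
            d j₀          ≤⟨ ≤θ+excess (d j₀) ⟩
            θ + e j₀      ≤⟨ +-monoʳ-≤ θ e-j₀≤0 ⟩
            θ + 0#        ≡⟨ R.+-identityʳ θ ⟩
            θ             ∎))
          where
          ∑Te : Carrier
          ∑Te = ∑ (allFin n) λ j → [ lookup T j ]· e j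
          term : ∀ j → [ lookup T j ]· θ + [ lookup T j ]· e j ≤ [ lookup (part i) j ]· raised T j
          term j with lookup T j in eq
          ... | false = O.trans (O.reflexive (R.+-identityˡ 0#))
                                ([]·-nonNegative (lookup (part i) j) (0≤p⁻ j))
          ... | true with G⇒ (T⊆G (lookup⇒[]= j T eq))
          ...   | j∈i , d≰θ rewrite j∈i with d j O.≤? θ
          ...     | yes d≤θ = ⊥-elim (d≰θ d≤θ)
          ...     | no _    = O.trans (O.reflexive (θ+[x-θ]≡x (d j))) (d≤p⁺ j)
          R+∑Te≤R : R* + ∑Te ≤ R* + 0#
          R+∑Te≤R = begin
            R* + ∑Te                  ≡⟨ cong (_+ ∑Te) Γ*θ≡R ⟨
            fromℕ Γ * θ + ∑Te         ≡⟨ cong (λ k → fromℕ k * θ + ∑Te) ∣T∣≡Γ ⟨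
            fromℕ ∣ T ∣ * θ + ∑Te     ≡⟨ cong (_+ ∑Te) (∑-subset T θ) ⟨
            ∑ (allFin n) (λ j → [ lookup T j ]· θ) + ∑Te
              ≡⟨ ∑-distrib-+ _ _ (allFin n) ⟨
            ∑ (allFin n) (λ j → [ lookup T j ]· θ + [ lookup T j ]· e j)
              ≤⟨ ∑-mono (allFin n) (λ {j} _ → term j) ⟩
            ∑ (allFin n) (λ j → [ lookup (part i) j ]· raised T j)
              ≤⟨ raised-load T ∣T∣≤Γ i ⟩
            R*                        ≡⟨ R.+-identityʳ R* ⟨
            R* + 0#                   ∎
          e-j₀≤0 : e j₀ ≤ 0#
          e-j₀≤0 = begin
            e j₀                        ≡⟨ cong ([_]· e j₀) ([]=⇒lookup j₀∈T) ⟨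
            [ lookup T j₀ ]· e j₀
              ≤⟨ ≤-∑ {f = λ j → [ lookup T j ]· e j}
                   (λ j → []·-nonNegative (lookup T j) (excess-nonNegative (d j))) (∈-allFin j₀) ⟩
            ∑Te                         ≤⟨ +-cancelˡ-≤ R* R+∑Te≤R ⟩
            0#                          ∎

      module _ (bal : BalancedPartition a d 0≤p⁻ m (allFin n)) where

        open BalancedPartition bal renaming (part to g; part-↭ to g-↭)

        -- `S*` bounds the total by `m` times `R*`, so some part has load at most `R*`, and the gap
        -- adds at most another `R*` for the others.
        gap⇒≤ : ∀ {f : Fin n → Carrier} → (∀ j → 0# ≤ f j) →
                (∀ i → ∑ (allFin n) (λ j → [ lookup (part i) j ]· f j) ≤ R*) →
                (∀ i k → ∑ (g i) f ≤ ∑ (g k) f + R*) → ∀ i → ∑ (g i) f ≤ R* + R*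
        gap⇒≤ {f} 0≤f S*≤R gap i
          with k , k≤R ← ∑-average (λ k → ∑ (g k) f) R* (∈-allFin i) (begin
                 ∑ (allFin m) (λ k → ∑ (g k) f)     ≡⟨ ∑-concatMap f g (allFin m) ⟨
                 ∑ (concatMap g (allFin m)) f       ≡⟨ ∑-↭ f g-↭ ⟩
                 ∑ (allFin n) f                     ≤⟨ ∑-≤-parts S* 0≤f ⟩
                 ∑ (allFin m) (λ i → ∑ (allFin n) λ j → [ lookup (part i) j ]· f j)
                                                    ≤⟨ ∑-mono (allFin m) (λ {i} _ → S*≤R i) ⟩
                 ∑ (allFin m) (λ _ → R*)            ∎)
          = O.trans (gap i k) (+-monoˡ-≤ R* k≤R)

        e-scale : Scale a d 0≤p⁻ e R*
        e-scale = record
          { 0≤M         = 0≤R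
          ; nonNegative = λ j → excess-nonNegative (d j)
          ; monotone    = excess-mono
          ; bounded     = λ j → excess≤ 0≤R (O.trans (d≤p⁺ j) (p⁺≤R j)) }

        -- The 5 is 2 + 1 + 2: lower sizes, `θ` for each raised job, and excess. The excess is
        -- charged for all jobs, raised or not, so its bound is free of `T`.
        balanced-≤ : ∀ p → InBudgetSet p⁻ p⁺ Γ p → ∀ k → ∑ (g k) (lookup p) ≤ fromℕ 5 * R*
        balanced-≤ p (T , ∣T∣≤Γ , out , ins) k = begin
          ∑ (g k) (lookup p)
            ≤⟨ ∑-mono (g k) (λ {j} _ → p≤ j) ⟩
          ∑ (g k) (λ j → a j + (τ j + e j))
            ≡⟨ trans (∑-distrib-+ a _ (g k)) (cong (∑ (g k) a +_) (∑-distrib-+ τ e (g k))) ⟩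
          ∑ (g k) a + (∑ (g k) τ + ∑ (g k) e)
            ≤⟨ +-mono-≤
                 (gap⇒≤ 0≤p⁻ p⁻-load (part-gap 0≤R λ j → O.trans (p⁻≤p⁺ j) (p⁺≤R j)) k)
                 (+-mono-≤ τ≤R
                   (gap⇒≤ (λ j → excess-nonNegative (d j)) excess-load (scale-gap e-scale) k)) ⟩
          R* + R* + (R* + (R* + R*))
            ≡⟨ solve 1 (λ r → r :+ r :+ (r :+ (r :+ r)) := nat 5 :* r) refl R* ⟩
          fromℕ 5 * R* ∎
          where
          τ : Fin n → Carrier
          τ j = [ lookup T j ]· θ
          τ-nonNegative : ∀ j → 0# ≤ τ j
          τ-nonNegative j = []·-nonNegative (lookup T j) 0≤θ
          p≤ : ∀ j → lookup p j ≤ a j + (τ j + e j)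
          p≤ j with lookup T j in eq
          ... | false = O.trans (O.reflexive (out j λ j∈T → true≢false (trans (sym ([]=⇒lookup j∈T)) eq)))
                                (x≤x+y (+-nonNegative O.refl (excess-nonNegative (d j))))
            where
            true≢false : true ≢ false
            true≢false ()
          ... | true  = begin
            lookup p j         ≤⟨ proj₂ (ins j (lookup⇒[]= j T eq)) ⟩
            lookup p⁺ j        ≡⟨ x+[y-x]≡y (a j) (lookup p⁺ j) ⟨
            a j + d j          ≤⟨ +-monoʳ-≤ (a j) (≤θ+excess (d j)) ⟩
            a j + (θ + e j)    ∎
          -- Even all raised jobs together are charged at most Γ θ = `R*`, so their distribution
          -- over the parts does not matter.
          τ≤R : ∑ (g k) τ ≤ R*
          τ≤R = begin
            ∑ (g k) τ                      ≤⟨ ∑-∈-concat τ-nonNegative (∈-map⁺ g (∈-allFin k)) ⟩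
            ∑ (concatMap g (allFin m)) τ   ≡⟨ ∑-↭ τ g-↭ ⟩
            ∑ (allFin n) τ                 ≡⟨ ∑-subset T θ ⟩
            fromℕ ∣ T ∣ * θ                ≤⟨ *-monoʳ-≤ 0≤θ (fromℕ-mono ∣T∣≤Γ) ⟩
            fromℕ Γ * θ                    ≡⟨ Γ*θ≡R ⟩
            R*                             ∎

-- The algorithm and its two guarantees.

module Main (ℝ : Reals) where

  open OrderedField ℝ
  open Scheduling ℝ
  open Refinement ℝ
  open Balancing ℝ
  open Robustness ℝ

  module _ (lam : Carrier) (0<lam : 0# < lam) where

    Hypotheses : ∀ {n} → (p⁻ p⁺ p̂ : Sizes n) → Set
    Hypotheses p⁻ p⁺ p̂ = NonNegative p⁻ × p⁻ ≤ᵛ p⁺ × p⁻ ≤ᵛ p̂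

    hypotheses? : ∀ {n} (p⁻ p⁺ p̂ : Sizes n) → Dec (Hypotheses p⁻ p⁺ p̂)
    hypotheses? p⁻ p⁺ p̂ =
      Fin.all? (λ j → 0# O.≤? lookup p⁻ j) ×-dec
      Fin.all? (λ j → lookup p⁻ j O.≤? lookup p⁺ j) ×-dec
      Fin.all? (λ j → lookup p⁻ j O.≤? lookup p̂ j)

    module _ {m n : ℕ} .{{_ : NonZero m}} (p⁻ p⁺ p̂ : Sizes n) where

      -- `worstCase` and `OPTʳᵒᵇ` take the proof of `p⁻ ≤ᵛ p⁺` as an argument, so the bound is
      -- stated for every such proof.
      Solves : Schedule m n → Set
      Solves S = Cmax S p̂ ≤ (1# + fromℕ 2 * lam ⁻¹) * OPT m p̂
        × (∀ (p⁻≤p⁺ : p⁻ ≤ᵛ p⁺) (Γ : ℕ) → 1 ℕ.≤ Γ →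
             worstCase p⁻ p⁺ p⁻≤p⁺ Γ S ≤ (fromℕ 10 * lam + fromℕ 20) * OPTʳᵒᵇ p⁻ p⁺ p⁻≤p⁺ Γ m)

      0<μ : 0# < fromℕ 2 * lam
      0<μ = *-pos (fromℕ-positive {2} (ℕ.s≤s ℕ.z≤n)) 0<lam

      module _ (0≤p⁻ : NonNegative p⁻) (p⁻≤p̂ : p⁻ ≤ᵛ p̂)
               (P : Carrier) (S° : Schedule m n) (S°≤P : ∀ i → load S° p̂ i ≤ P) where

        open Schedule S°

        0≤p̂ : NonNegative p̂
        0≤p̂ j = O.trans (0≤p⁻ j) (p⁻≤p̂ j)

        ∑-part≤P : ∀ i → ∑ (allFin n) (λ j → [ lookup (part i) j ]· lookup p̂ j) ≤ P
        ∑-part≤P i = subst (_≤ P) (load-∑ S° p̂ i) (S°≤P i)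

        0≤P : 0# ≤ P
        0≤P = O.trans (∑-nonNegative (allFin n) λ j → []·-nonNegative (lookup (part i₀) j) (0≤p̂ j))
                      (∑-part≤P i₀)

        -- This choice serves both guarantees: 4h = 2P/λ is the permitted nominal loss, and P = 2λh
        -- lets pieces above `h` be counted.
        h : Carrier
        h = (fromℕ 2 * lam) ⁻¹ * P

        0≤h : 0# ≤ h
        0≤h = *-nonNegative (⁻¹-nonNegative 0<μ) 0≤P

        μ*h≡P : fromℕ 2 * lam * h ≡ P
        μ*h≡P = x*[x⁻¹*y]≡y P 0<μ

        balancedPartition : BalancedPartition (lookup p⁻) (λ j → lookup p⁺ j + - lookup p⁻ j) 0≤p⁻
                                              m (allFin n)
        balancedPartition = balanced _ _ 0≤p⁻ m (ℕ.>-nonZero⁻¹ m) (allFin n)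

        open BalancedPartition balancedPartition renaming (part to g; part-↭ to g-↭)

        σ : Fin n → Fin m
        σ j = proj₁ (covers j)

        σ≤P : ∀ i → ∑ (allFin n) (λ j → [ does (σ j Fin.≟ i) ]· lookup p̂ j) ≤ P
        σ≤P i = O.trans (∑-mono (allFin n) λ {j} _ → σ≤part j) (∑-part≤P i)
          where
          σ≤part : ∀ j → [ does (σ j Fin.≟ i) ]· lookup p̂ j ≤ [ lookup (part i) j ]· lookup p̂ j
          σ≤part j with σ j Fin.≟ i
          ... | no _     = []·-nonNegative (lookup (part i) j) (0≤p̂ j)
          ... | yes refl = O.reflexive (cong ([_]· lookup p̂ j) (sym ([]=⇒lookup (proj₂ (covers j)))))

        total≤ : ∑ (allFin n) (lookup p̂) ≤ ∑ (allFin m) λ _ → P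
        total≤ = O.trans (∑-≤-parts S° 0≤p̂) (∑-mono (allFin m) λ {i} _ → ∑-part≤P i)

        -- Built before any budget is fixed; Γ first enters in `solution-robust`, so one schedule
        -- serves all budgets.
        solution : Schedule m n
        solution = refined p̂ 0≤p̂ 0≤h g g-↭ σ σ≤P total≤ i₀

        solution-p̂ : ∀ i → load solution p̂ i ≤ (1# + fromℕ 2 * lam ⁻¹) * P
        solution-p̂ i = begin
          load solution p̂ i
            ≤⟨ refined-p̂ p̂ 0≤p̂ 0≤h g g-↭ σ σ≤P total≤ i₀ i ⟩
          P + (h + h) + h
            -- The loss 3h is rounded up to 4h, which equals 2P/λ.
            ≤⟨ x≤x+y 0≤h ⟩
          P + (h + h) + h + h
            ≡⟨ solve 2 (λ P h → P :+ (h :+ h) :+ h :+ h := P :+ nat 2 :* (nat 2 :* h)) refl P h ⟩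
          P + fromℕ 2 * (fromℕ 2 * h)
            ≡⟨ cong (λ x → P + fromℕ 2 * x) (sym lam⁻¹*P≡2h) ⟩
          P + fromℕ 2 * (lam ⁻¹ * P)
            ≡⟨ solve 2 (λ P l → P :+ nat 2 :* (l :* P) := (con 1 :+ nat 2 :* l) :* P) refl P (lam ⁻¹) ⟩
          (1# + fromℕ 2 * lam ⁻¹) * P ∎
          where
          lam⁻¹*P≡2h : lam ⁻¹ * P ≡ fromℕ 2 * h
          lam⁻¹*P≡2h = begin-equality
            lam ⁻¹ * P                        ≡⟨ cong (lam ⁻¹ *_) μ*h≡P ⟨
            lam ⁻¹ * (fromℕ 2 * lam * h)
              ≡⟨ solve 3 (λ k l h → k :* (nat 2 :* l :* h) := l :* (k :* (nat 2 :* h)))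
                   refl (lam ⁻¹) lam h ⟩
            lam * (lam ⁻¹ * (fromℕ 2 * h))    ≡⟨ x*[x⁻¹*y]≡y (fromℕ 2 * h) 0<lam ⟩
            fromℕ 2 * h                       ∎

        solution-robust : ∀ (p⁻≤p⁺ : p⁻ ≤ᵛ p⁺) Γ → 1 ℕ.≤ Γ → (R* : Carrier) (S* : Schedule m n) →
          RobustlyBounded p⁻ p⁺ Γ S* R* →
          RobustlyBounded p⁻ p⁺ Γ solution ((fromℕ 10 * lam + fromℕ 20) * R*)
        solution-robust p⁻≤p⁺ Γ 1≤Γ R* S* S*≤R p u@(T , _ , out , ins) i = begin
          load solution p i
            ≤⟨ refined-≤ p̂ 0≤p̂ 0≤h g g-↭ σ σ≤P total≤ i₀ (proj₁ 0<μ) μ*h≡P {p} 0≤p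
                 (LowerBounds.balanced-≤ p⁻ p⁺ 0≤p⁻ p⁻≤p⁺ Γ 1≤Γ R* S* S*≤R
                   balancedPartition p u) i ⟩
          -- `refined-≤` with μ = 2λ, where every part costs at most 5 `R*`.
          (fromℕ 2 * lam + fromℕ 4) * (fromℕ 5 * R*)
            ≡⟨ solve 2 (λ l r → (nat 2 :* l :+ nat 4) :* (nat 5 :* r) := (nat 10 :* l :+ nat 20) :* r)
                 refl lam R* ⟩
          (fromℕ 10 * lam + fromℕ 20) * R* ∎
          where
          0≤p : NonNegative p
          0≤p j with j Subset.∈? T
          ... | yes j∈T = O.trans (0≤p⁻ j) (proj₁ (ins j j∈T))
          ... | no j∉T  = O.trans (0≤p⁻ j) (O.reflexive (sym (out j j∉T)))

      solve-instance : Hypotheses p⁻ p⁺ p̂ → ∃ Solves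
      solve-instance (0≤p⁻ , _ , p⁻≤p̂) = S
        , Cmax-least S p̂ (solution-p̂ 0≤p⁻ p⁻≤p̂ P S° S°≤P)
        , robust
        where
        P : Carrier
        P = OPT m p̂
        S° : Schedule m n
        S° = proj₁ (proj₁ (proj₂ (OPT-minimum m p̂)))
        S°≤P : ∀ i → load S° p̂ i ≤ P
        S°≤P i = O.trans (load≤Cmax S° p̂ i) (O.reflexive (proj₂ (proj₁ (proj₂ (OPT-minimum m p̂)))))
        S : Schedule m n
        S = solution 0≤p⁻ p⁻≤p̂ P S° S°≤P
        robust : ∀ (p⁻≤p⁺ : p⁻ ≤ᵛ p⁺) (Γ : ℕ) → 1 ℕ.≤ Γ →
                 worstCase p⁻ p⁺ p⁻≤p⁺ Γ S ≤ (fromℕ 10 * lam + fromℕ 20) * OPTʳᵒᵇ p⁻ p⁺ p⁻≤p⁺ Γ m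
        robust p⁻≤p⁺ Γ 1≤Γ = worstCase-least p⁻ p⁺ p⁻≤p⁺ Γ S
          (solution-robust 0≤p⁻ p⁻≤p̂ P S° S°≤P p⁻≤p⁺ Γ 1≤Γ
            (OPTʳᵒᵇ p⁻ p⁺ p⁻≤p⁺ Γ m) (robustOptimum p⁻ p⁺ p⁻≤p⁺ Γ)
            (robustOptimum-bounded p⁻ p⁺ p⁻≤p⁺ Γ))

      -- An Algorithm is total, also off the hypotheses.
      decide : Dec (Hypotheses p⁻ p⁺ p̂) → Schedule m n
      decide (yes hyp) = proj₁ (solve-instance hyp)
      decide (no _)    = allOnFirst m

      decide-solves : ∀ dec → Hypotheses p⁻ p⁺ p̂ → Solves (decide dec)
      decide-solves (yes hyp) _   = proj₂ (solve-instance hyp)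
      decide-solves (no ¬hyp) hyp = ⊥-elim (¬hyp hyp)

    algorithm : Algorithm
    algorithm m n p⁻ p⁺ p̂ = decide {m} p⁻ p⁺ p̂ (hypotheses? p⁻ p⁺ p̂)

theorem10 : (ℝ : Reals) → let open Reals ℝ in let open Scheduling ℝ in
    (lam : Carrier) → 0# < lam →
    Σ Algorithm λ alg → ((m n : ℕ) .{{_ : NonZero m}} (p⁻ p⁺ p̂ : Sizes n) →
    NonNegative p⁻ → (p⁻≤p⁺ : p⁻ ≤ᵛ p⁺) → p⁻ ≤ᵛ p̂ → p̂ ≤ᵛ p⁺ →
    let S = alg m n p⁻ p⁺ p̂ in
    (Cmax S p̂ ≤ (1# + fromℕ 2 * lam ⁻¹) * OPT m p̂)
    × (∀ (Γ : ℕ) → 1 ℕ.≤ Γ → Γ ℕ.≤ n →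
    worstCase p⁻ p⁺ p⁻≤p⁺ Γ S ≤ (fromℕ 10 * lam + fromℕ 20) * OPTʳᵒᵇ p⁻ p⁺ p⁻≤p⁺ Γ m))
theorem10 ℝ lam 0<lam = algorithm lam 0<lam , λ m n p⁻ p⁺ p̂ 0≤p⁻ p⁻≤p⁺ p⁻≤p̂ p̂≤p⁺ →
  let nominal , robust = decide-solves lam 0<lam {m} p⁻ p⁺ p̂ (hypotheses? lam 0<lam p⁻ p⁺ p̂)
                           (0≤p⁻ , p⁻≤p⁺ , p⁻≤p̂)
  in nominal , λ Γ 1≤Γ _ → robust p⁻≤p⁺ Γ 1≤Γ
  where open Main ℝ
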